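{- For every integer $n \geq 1$, $$\pi(p_{3n}) - \pi\left(\tfrac{1}{2}p_{3n}\right) > n,$$ where $p_k$ denotes the $k$th prime and $\pi(x)$ denotes the number of primes not exceeding $x$.
   Context: $\pi(x)$ is the prime-counting function, defined for real $x$ as the number of primes $\leq x$; $p_k$ is the $k$th prime ($p_1 = 2$). -}

module Defs where

open import Data.Nat using (ℕ; zero; suc; _+_)
open import Data.Nat.Primality using (Prime; prime?)
open import Relation.Nullary.Decidable using (does)
open import Data.Bool using (if_then_else_)
open import Relation.Binary.PropositionalEquality using (_≡_)
open import Data.Product using (_×_)

π : ℕ → ℕ
π zero = 0
π (suc x) = (if does (prime? (suc x)) then 1 else 0) + π x

-- p is the k-th prime (p₁ = 2): p is prime and exactly k primes are ≤ p
IsNthPrime : ℕ → ℕ → Set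
IsNthPrime k p = Prime p × π p ≡ k

-- An odd prime p is 2m + 1 with m = ⌊p/2⌋, so the claim is 3 π(m) < 2 π(2m + 1).
--
-- For large m suppose the contrary, so that (m, 2m] contains at most π(m)/2 primes.  Then
--   C(2m, m)² ≤ (2m)^(2 π(√(2m))) · P(2m/3)² · (2m)^π(m),   P(n) = ∏ p ≤ n prime,
-- because primes in (2m/3, m] do not divide C(2m, m) and those above √(2m) divide it at most once.
-- Chebyshev-type bounds on the right contradict C(2m, m) ≥ 4^m / (2m + 1):
--   * P(n)^7 ≤ 2^(11n + 360), from Hanson's integers n! / ∏ ⌊n/a⌋! with a = 2, 3, 7, 43, 1806
--     (∑ 1/a = 1), which are divisible by every prime in (n/1806, n];
--   * (n + 1)^π(n) ≤ P(n) · 2^(π(n) + π(n/2) + π(n/4) + ⋯);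
--   * 10 π(n) ≤ n + 2750, by induction on n from the previous two.
-- In bits per unit of m these give 44/21 + 11/7 + 3/10 < 4 (for P(2m/3)², P(m) and the power of 2),
-- and the remaining terms are small for m ≥ 2^19; all m ≤ 2^19 are checked by computation.
module Submission where

open import Defs
open import Data.Bool using (Bool; true; false; if_then_else_; _∨_; not; T)
open import Data.Empty using (⊥-elim)
open import Data.List using (List; []; _∷_; map; length)
open import Data.List.Properties using (map-∘)
open import Data.List.Membership.Propositional using (_∈_; find)
open import Data.List.Relation.Unary.All as All using (All; []; _∷_; all?)
open import Data.List.Relation.Unary.AllPairs using (AllPairs; []; _∷_; allPairs?)
open import Data.List.Relation.Unary.Any using (Any; here; there; any?)
open import Data.Nat
open import Data.Nat.Combinatorics using (k![n∸k]!∣n!)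
open import Data.Nat.Divisibility
open import Data.Nat.DivMod
open import Data.Nat.Induction using (<-rec)
open import Data.Nat.ListAction using (sum; product)
open import Data.Nat.Primality
open import Data.Nat.Primality.Factorisation using (factorise)
open import Data.Nat.Properties
open import Data.Nat.Tactic.RingSolver using (solve-∀)
open import Data.Product using (_×_; _,_; proj₁; proj₂; ∃; ∃₂; ∃-syntax)
open import Data.Sum using (inj₁; inj₂; [_,_]′)
open import Data.Unit using (tt)
open import Function.Base using (_∘′_; case_of_; flip; id)
open import Relation.Binary.PropositionalEquality
open import Relation.Nullary using (¬_; yes; no; does; contradiction)
open import Relation.Nullary.Decidable using (dec-true; dec-false; toWitness; _→-dec_)

-- The obstacle is the budget of 4 bits per unit of m. With the classical P(n) ≤ 4^n, the factors
-- P(2m/3)² and P(m) would already cost 8/3 + 2 > 4. A rate of c bits costs 4c/3 + c = 7c/3, so c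
-- must stay below 12/7; Hanson's integers give 11/7, which costs 11/3 and leaves 1/3. The power of
-- 2 that accompanies P(m) has exponent 2π(m) + π(m/2) + π(m/4) + ⋯, and a slope of 1/10 for π makes
-- this about 3m/10, just inside that 1/3. Squaring C(2m, m) removes the half in π(m)/2. Logarithms
-- are avoided: estimates are inequalities between products of powers, raised to the 7th or 1806th
-- power where that makes exponents integral, and only exponents of 2 are compared at the end. The
-- induction for the linear bound closes only once log₂ n outweighs its constants, so that bound
-- needs a computed starting range too. The same computation serves the bound and the claim.

private variable
  m n p : ℕ

-- Prime counting and primorials: recursion and monotonicity

π-prime : Prime (suc n) → π (suc n) ≡ suc (π n)
π-prime {n} pr rewrite dec-true (prime? (suc n)) pr = refl

π-nonprime : ¬ Prime (suc n) → π (suc n) ≡ π n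
π-nonprime {n} ¬pr rewrite dec-false (prime? (suc n)) ¬pr = refl

π-step : ∀ n → π n ≤ π (suc n)
π-step n = m≤n+m (π n) _

mono-from-step : (f : ℕ → ℕ) → (∀ n → f n ≤ f (suc n)) → m ≤ n → f m ≤ f n
mono-from-step {m} f step m≤n with ≤⇒≤′ m≤n
... | ≤′-refl = ≤-refl
... | ≤′-step m≤′n = ≤-trans (mono-from-step f step (≤′⇒≤ m≤′n)) (step _)

π-mono : m ≤ n → π m ≤ π n
π-mono = mono-from-step π π-step

primorial : ℕ → ℕ
primorial zero    = 1
primorial (suc n) = (if does (prime? (suc n)) then suc n else 1) * primorial n

primorial-prime : Prime (suc n) → primorial (suc n) ≡ suc n * primorial n
primorial-prime {n} pr rewrite dec-true (prime? (suc n)) pr = refl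

primorial-step : ∀ n → primorial n ≤ primorial (suc n)
primorial-step n with prime? (suc n)
... | yes pr = m≤n*m (primorial n) (suc n)
... | no ¬pr = m≤n*m (primorial n) 1

primorial-mono : m ≤ n → primorial m ≤ primorial n
primorial-mono = mono-from-step primorial primorial-step

primorial>0 : ∀ n → primorial n > 0
primorial>0 n = primorial-mono {0} {n} z≤n

-- Factorials and Legendre's formula

∏! : List ℕ → ℕ
∏! []       = 1
∏! (k ∷ ks) = k ! * ∏! ks

∏!-nonZero : ∀ ks → NonZero (∏! ks)
∏!-nonZero []       = _
∏!-nonZero (k ∷ ks) = m*n≢0 (k !) (∏! ks) {{k !≢0}} {{∏!-nonZero ks}}

m!*n!∣[m+n]! : ∀ m n → m ! * n ! ∣ (m + n) !
m!*n!∣[m+n]! m n = subst (λ k → m ! * k ! ∣ (m + n) !) (m+n∸m≡n m n) (k![n∸k]!∣n! (m≤m+n m n))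

∏!∣sum! : ∀ ks → ∏! ks ∣ sum ks !
∏!∣sum! []       = ∣-refl
∏!∣sum! (k ∷ ks) = ∣-trans (*-monoʳ-∣ (k !) (∏!∣sum! ks)) (m!*n!∣[m+n]! k (sum ks))

!-mono-∣ : m ≤ n → m ! ∣ n !
!-mono-∣ {m} {n} m≤n = subst (λ k → m ! ∣ k !) (m+[n∸m]≡n m≤n)
  (∣-trans (m∣m*n ((n ∸ m) !)) (m!*n!∣[m+n]! m (n ∸ m)))

quotient-unique : .{{_ : NonZero p}} → ∀ {q} → q * p ≤ n → n < suc q * p → n / p ≡ q
quotient-unique {p} {n} {q} q*p≤n n<[1+q]*p = ≤-antisym
  (≤-pred (m<n*o⇒m/o<n n<[1+q]*p))
  (subst (_≤ n / p) (m*n/n≡m q p) (/-monoˡ-≤ p q*p≤n))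

n<[1+n/p]*p : ∀ n p .{{_ : NonZero p}} → n < suc (n / p) * p
n<[1+n/p]*p n p = subst (_< p + n / p * p) (sym (m≡m%n+[m/n]*n n p)) (+-monoˡ-< (n / p * p) (m%n<n n p))

/-suc-∣ : .{{_ : NonZero p}} → p ∣ suc n → suc n / p ≡ suc (n / p)
/-suc-∣ {p@(suc p-1)} {n} (divides (suc q) eq) =
  trans (quotient-unique {p} {q = suc q} (≤-reflexive (sym eq))
          (subst (_< suc (suc q) * p) (sym eq) (m<n+m (suc q * p) z<s)))
    (cong suc (sym (quotient-unique {p} {n} {q = q}
      (≤-pred (subst (q * p <_) (sym eq) (m<n+m (q * p) z<s))) (≤-reflexive eq))))

/-suc-∤ : .{{_ : NonZero p}} → ¬ p ∣ suc n → suc n / p ≡ n / p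
/-suc-∤ {p} {n} ¬p∣ = quotient-unique (m≤n⇒m≤1+n (m/n*n≤m n p))
  (≤∧≢⇒< (n<[1+n/p]*p n p) λ eq → ¬p∣ (divides (suc (n / p)) eq))

prime∤1 : Prime p → ¬ p ∣ 1
prime∤1 pr p∣1 = ¬prime[1] (subst Prime (∣1⇒≡1 p∣1) pr)

prime∤* : Prime p → ∀ {m n} → ¬ p ∣ m → ¬ p ∣ n → ¬ p ∣ m * n
prime∤* pr {m} {n} ¬p∣m ¬p∣n = [ ¬p∣m , ¬p∣n ]′ ∘′ euclidsLemma m n pr

module _ {p} (pr : Prime p) .{{_ : NonZero p}} where

  -- The multiples of p up to n contribute p^(n/p) times (n/p)!, and the other factors make up u.
  -- Keeping (n/p)! unexpanded lets later divisibility questions be settled after a single division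
  -- by p.
  legendre : ∀ n → ∃[ u ] ¬ p ∣ u × n ! ≡ p ^ (n / p) * ((n / p) ! * u)
  legendre zero = 1 , prime∤1 pr , sym (cong (λ k → p ^ k * (k ! * 1)) (0/n≡0 p))
  legendre (suc n) with p ∣? suc n | legendre n
  ... | yes p∣1+n | u , ¬p∣u , eq = u , ¬p∣u , (begin-equality
    suc n * n !                                    ≡⟨ cong₂ _*_ (sym (m/n*n≡m p∣1+n)) eq ⟩
    suc n / p * p * (p ^ q * (q ! * u))            ≡⟨ cong (λ k → k * p * (p ^ q * (q ! * u))) (/-suc-∣ p∣1+n) ⟩
    suc q * p * (p ^ q * (q ! * u))                ≡⟨ assoc q p (p ^ q) (q !) u ⟩
    p ^ suc q * (suc q ! * u)                      ≡⟨ cong (λ k → p ^ k * (k ! * u)) (/-suc-∣ p∣1+n) ⟨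
    p ^ (suc n / p) * ((suc n / p) ! * u)          ∎)
    where
    open ≤-Reasoning
    q = n / p
    assoc : ∀ q p x y u → suc q * p * (x * (y * u)) ≡ p * x * ((suc q * y) * u)
    assoc = solve-∀
  ... | no ¬p∣1+n | u , ¬p∣u , eq = suc n * u , prime∤* pr ¬p∣1+n ¬p∣u , (begin-equality
    suc n * n !                                    ≡⟨ cong (suc n *_) eq ⟩
    suc n * (p ^ q * (q ! * u))                    ≡⟨ assoc (suc n) (p ^ q) (q !) u ⟩
    p ^ q * (q ! * (suc n * u))                    ≡⟨ cong (λ k → p ^ k * (k ! * (suc n * u))) (/-suc-∤ ¬p∣1+n) ⟨
    p ^ (suc n / p) * ((suc n / p) ! * (suc n * u)) ∎)
    where
    open ≤-Reasoning
    q = n / p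
    assoc : ∀ a x y u → a * (x * (y * u)) ≡ x * (y * (a * u))
    assoc = solve-∀

  legendre-∏! : ∀ ks → ∃[ u ] ¬ p ∣ u × ∏! ks ≡ p ^ sum (map (_/ p) ks) * (∏! (map (_/ p) ks) * u)
  legendre-∏! []       = 1 , prime∤1 pr , refl
  legendre-∏! (k ∷ ks) with u , ¬p∣u , eq ← legendre k | v , ¬p∣v , eqs ← legendre-∏! ks =
    u * v , prime∤* pr ¬p∣u ¬p∣v , (begin-equality
      k ! * ∏! ks                                        ≡⟨ cong₂ _*_ eq eqs ⟩
      p ^ q * (q ! * u) * (p ^ s * (∏! qs * v))          ≡⟨ assoc (p ^ q) (q !) u (p ^ s) (∏! qs) v ⟩
      p ^ q * p ^ s * (q ! * ∏! qs * (u * v))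
        ≡⟨ cong (_* (q ! * ∏! qs * (u * v))) (^-distribˡ-+-* p q s) ⟨
      p ^ (q + s) * (q ! * ∏! qs * (u * v))              ∎)
    where
    open ≤-Reasoning
    q = k / p
    qs = map (_/ p) ks
    s = sum qs
    assoc : ∀ a b u c d v → a * (b * u) * (c * (d * v)) ≡ a * c * (b * d * (u * v))
    assoc = solve-∀

  -- One step of Legendre gives n! a surplus of N - s factors p over `∏! ks`. The quotient N! /
  -- `∏! qs` that remains is an integer because s < N, which accounts for all higher powers of p at
  -- once; a factor p is left for M.
  ∣-multinomial : ∀ {M} ks n → M * ∏! ks ≡ n ! → sum (map (_/ p) ks) < n / p → p ∣ M
  ∣-multinomial {M} ks n eq s<N
    with u , ¬p∣u , eqₙ ← legendre n | v , ¬p∣v , eqₖ ← legendre-∏! ks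
    with divides c N!≡ ← ∣-trans (∏!∣sum! (map (_/ p) ks)) (!-mono-∣ (<⇒≤ s<N)) =
    [ id , flip contradiction ¬p∣v ]′ (euclidsLemma M v pr (divides (p ^ d * (c * u)) M*v≡))
    where
    qs = map (_/ p) ks
    N = n / p
    s = sum qs
    d = N ∸ suc s
    N≡ : N ≡ s + suc d
    N≡ = sym (trans (+-suc s d) (m+[n∸m]≡n s<N))
    open ≤-Reasoning
    instance
      _ = m*n≢0 (p ^ s) (∏! qs) {{m^n≢0 p s}} {{∏!-nonZero qs}}
    assoc₁ : ∀ x y m v → m * v * (x * y) ≡ m * (x * (y * v))
    assoc₁ = solve-∀
    assoc₂ : ∀ x p z c y u → x * (p * z) * (c * y * u) ≡ z * (c * u) * p * (x * y)
    assoc₂ = solve-∀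
    M*v≡ : M * v ≡ p ^ d * (c * u) * p
    M*v≡ = *-cancelʳ-≡ _ _ (p ^ s * ∏! qs) (begin-equality
      M * v * (p ^ s * ∏! qs)                 ≡⟨ assoc₁ (p ^ s) (∏! qs) M v ⟩
      M * (p ^ s * (∏! qs * v))               ≡⟨ cong (M *_) eqₖ ⟨
      M * ∏! ks                               ≡⟨ eq ⟩
      n !                                     ≡⟨ eqₙ ⟩
      p ^ N * (N ! * u)                       ≡⟨ cong₂ (λ x y → p ^ x * (y * u)) N≡ N!≡ ⟩
      p ^ (s + suc d) * (c * ∏! qs * u)       ≡⟨ cong (_* (c * ∏! qs * u)) (^-distribˡ-+-* p s (suc d)) ⟩
      p ^ s * (p * p ^ d) * (c * ∏! qs * u)   ≡⟨ assoc₂ (p ^ s) p (p ^ d) c (∏! qs) u ⟩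
      p ^ d * (c * u) * p * (p ^ s * ∏! qs)   ∎)

  prime∤! : ∀ {n} → n < p → ¬ p ∣ n !
  prime∤! {zero}  _   = prime∤1 pr
  prime∤! {suc n} n<p = prime∤* pr (>⇒∤ n<p) (prime∤! (<-trans (n<1+n n) n<p))

  -- The explicit powers of p cancel, and the remaining right side N! * u is coprime to p because N
  -- < p.
  ∤-multinomial : ∀ {M} ks n → M * ∏! ks ≡ n ! → sum (map (_/ p) ks) ≡ n / p → n / p < p → ¬ p ∣ M
  ∤-multinomial {M} ks n eq s≡N N<p p∣M
    with u , ¬p∣u , eqₙ ← legendre n | v , ¬p∣v , eqₖ ← legendre-∏! ks =
    prime∤* pr (prime∤! N<p) ¬p∣u (subst (p ∣_) M*v≡ (∣m⇒∣m*n (v * ∏! qs) p∣M))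
    where
    qs = map (_/ p) ks
    N = n / p
    open ≤-Reasoning
    instance
      _ = m^n≢0 p N
    assoc : ∀ x y m v → m * (v * y) * x ≡ m * (x * (y * v))
    assoc = solve-∀
    M*v≡ : M * (v * ∏! qs) ≡ N ! * u
    M*v≡ = *-cancelʳ-≡ _ _ (p ^ N) (begin-equality
      M * (v * ∏! qs) * p ^ N            ≡⟨ assoc (p ^ N) (∏! qs) M v ⟩
      M * (p ^ N * (∏! qs * v))          ≡⟨ cong (λ k → M * (p ^ k * (∏! qs * v))) s≡N ⟨
      M * (p ^ sum qs * (∏! qs * v))     ≡⟨ cong (M *_) eqₖ ⟨
      M * ∏! ks                          ≡⟨ eq ⟩
      n !                                ≡⟨ eqₙ ⟩
      p ^ N * (N ! * u)                  ≡⟨ *-comm (p ^ N) (N ! * u) ⟩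
      N ! * u * p ^ N                    ∎)

  -- Legendre's exponent ⌊n/p⌋ + ⌊n/p²⌋ + ⋯ cut off after t terms, complete once n < p^t.
  ν! : ℕ → ℕ → ℕ
  ν! n zero    = 0
  ν! n (suc t) = n / p + ν! (n / p) t

  n<p^[1+t]⇒n/p<p^t : ∀ {n} t → n < p ^ suc t → n / p < p ^ t
  n<p^[1+t]⇒n/p<p^t {n} t lt = m<n*o⇒m/o<n (subst (n <_) (*-comm p (p ^ t)) lt)

  legendre-full : ∀ t n → n < p ^ t → ∃[ u ] ¬ p ∣ u × n ! ≡ p ^ ν! n t * u
  legendre-full zero    zero    _  = 1 , prime∤1 pr , refl
  legendre-full zero    (suc n) lt = contradiction lt λ { (s≤s ()) }
  legendre-full (suc t) n       lt
    with u , ¬p∣u , eq ← legendre n | v , ¬p∣v , eq′ ← legendre-full t (n / p) (n<p^[1+t]⇒n/p<p^t t lt) =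
    v * u , prime∤* pr ¬p∣v ¬p∣u , (begin-equality
      n !                                   ≡⟨ eq ⟩
      p ^ (n / p) * ((n / p) ! * u)         ≡⟨ cong (λ k → p ^ (n / p) * (k * u)) eq′ ⟩
      p ^ (n / p) * (p ^ ν! (n / p) t * v * u) ≡⟨ assoc (p ^ (n / p)) (p ^ ν! (n / p) t) v u ⟩
      p ^ (n / p) * p ^ ν! (n / p) t * (v * u) ≡⟨ cong (_* (v * u)) (^-distribˡ-+-* p (n / p) _) ⟨
      p ^ (n / p + ν! (n / p) t) * (v * u)  ∎)
    where
    open ≤-Reasoning
    assoc : ∀ a b v u → a * (b * v * u) ≡ a * b * (v * u)
    assoc = solve-∀

  -- Each of the terms ⌊n / pⁱ⌋ exceeds ⌊a / pⁱ⌋ + ⌊b / pⁱ⌋ by at most one, and the last one vanishes.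
  ν!-subadditive : ∀ t {n} a b → n ≤ suc (a + b) → n < p ^ suc t → ν! n (suc t) ≤ ν! a (suc t) + ν! b (suc t) + t
  ν!-subadditive zero {n} a b n≤ n<p =
    ≤-trans (≤-reflexive (trans (+-identityʳ _) (m<n⇒m/n≡0 (subst (n <_) (*-identityʳ p) n<p)))) z≤n
  ν!-subadditive (suc t) {n} a b n≤ lt = begin
    n / p + ν! (n / p) (suc t)
      ≤⟨ +-mono-≤ n/p≤ (ν!-subadditive t (a / p) (b / p) n/p≤ (n<p^[1+t]⇒n/p<p^t (suc t) lt)) ⟩
    suc (a / p + b / p) + (ν! (a / p) (suc t) + ν! (b / p) (suc t) + t)
                                                   ≡⟨ rearrange (a / p) (b / p) (ν! (a / p) (suc t)) (ν! (b / p) (suc t)) t ⟩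
    a / p + ν! (a / p) (suc t) + (b / p + ν! (b / p) (suc t)) + suc t ∎
    where
    open ≤-Reasoning
    rearrange : ∀ a b c d t → suc (a + b) + (c + d + t) ≡ a + c + (b + d) + suc t
    rearrange = solve-∀
    n/p≤ : n / p ≤ suc (a / p + b / p)
    n/p≤ = ≤-pred (m<n*o⇒m/o<n (begin-strict
      n                                            ≤⟨ n≤ ⟩
      suc (a + b)                                  <⟨ s≤s (≤-reflexive (sym (+-suc a b))) ⟩
      suc a + suc b                                ≤⟨ +-mono-≤ (n<[1+n/p]*p a p) (n<[1+n/p]*p b p) ⟩
      suc (a / p) * p + suc (b / p) * p            ≡⟨ *-distribʳ-+ p (suc (a / p)) (suc (b / p)) ⟨
      (suc (a / p) + suc (b / p)) * p              ≡⟨ cong (λ k → suc k * p) (+-suc (a / p) (b / p)) ⟩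
      suc (suc (a / p + b / p)) * p                ∎))

  -- Kummer's bound: if a + b < p^(t+1), at most t terms of Legendre's sum can gain a carry, so C
  -- has at most t factors p.
  prime-power-∣-binomial : ∀ {C} a b k → C * ∏! (a ∷ b ∷ []) ≡ (a + b) ! → 1 ≤ a + b → p ^ k ∣ C → p ^ k ≤ a + b
  prime-power-∣-binomial a b zero        eq 1≤ p^k∣C = 1≤
  prime-power-∣-binomial {C} a b (suc t) eq 1≤ (divides c C≡) = ≮⇒≥ contra
    where
    open ≤-Reasoning
    contra : ¬ a + b < p ^ suc t
    contra lt
      with x , ¬p∣x , eqₙ ← legendre-full (suc t) (a + b) lt
         | y , ¬p∣y , eqₐ ← legendre-full (suc t) a (≤-<-trans (m≤m+n a b) lt)
         | z , ¬p∣z , eq_b ← legendre-full (suc t) b (≤-<-trans (m≤n+m b a) lt) =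
      ¬p∣x (divides (p ^ d * (c * y * z)) (sym (*-cancelʳ-≡ _ _ (p ^ νₙ) (begin-equality
        p ^ d * (c * y * z) * p * p ^ νₙ            ≡⟨ assoc₁ p (p ^ νₙ) (p ^ d) (c * y * z) ⟩
        p * (p ^ νₙ * p ^ d) * (c * y * z)          ≡⟨ cong (λ k → p * k * (c * y * z)) (^-distribˡ-+-* p νₙ d) ⟨
        p * p ^ (νₙ + d) * (c * y * z)              ≡⟨ cong (λ k → p * p ^ k * (c * y * z)) (m+[n∸m]≡n ν≤) ⟩
        p * p ^ (νₐ + ν_b + t) * (c * y * z)
          ≡⟨ cong (λ k → p * k * (c * y * z)) (^-distribˡ-+-* p (νₐ + ν_b) t) ⟩
        p * (p ^ (νₐ + ν_b) * p ^ t) * (c * y * z)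
          ≡⟨ cong (λ k → p * (k * p ^ t) * (c * y * z)) (^-distribˡ-+-* p νₐ ν_b) ⟩
        p * (p ^ νₐ * p ^ ν_b * p ^ t) * (c * y * z) ≡⟨ assoc₂ p (p ^ νₐ) (p ^ ν_b) (p ^ t) c y z ⟩
        c * (p * p ^ t) * (p ^ νₐ * y * (p ^ ν_b * z * 1))
          ≡⟨ cong₂ _*_ C≡ (cong₂ (λ k l → k * (l * 1)) eqₐ eq_b) ⟨
        C * ∏! (a ∷ b ∷ [])                         ≡⟨ eq ⟩
        (a + b) !                                   ≡⟨ eqₙ ⟩
        p ^ νₙ * x                                  ≡⟨ *-comm (p ^ νₙ) x ⟩
        x * p ^ νₙ                                  ∎))))
      where
      νₙ = ν! (a + b) (suc t)
      νₐ = ν! a (suc t)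
      ν_b = ν! b (suc t)
      ν≤ : νₙ ≤ νₐ + ν_b + t
      ν≤ = ν!-subadditive t a b (n≤1+n _) lt
      d = νₐ + ν_b + t ∸ νₙ
      instance
        _ = m^n≢0 p νₙ
      assoc₁ : ∀ p x y z → y * z * p * x ≡ p * (x * y) * z
      assoc₁ = solve-∀
      assoc₂ : ∀ p a b t c y z → p * (a * b * t) * (c * y * z) ≡ c * (p * t) * (a * y * (b * z * 1))
      assoc₂ = solve-∀

-- Hanson's bound for the primorial

prime∣primorial⇒≤ : ∀ n → Prime p → p ∣ primorial n → p ≤ n
prime∣primorial⇒≤ zero pr p∣1 = contradiction p∣1 (prime∤1 pr)
prime∣primorial⇒≤ {p} (suc n) pr p∣P with prime? (suc n)
... | yes _ = [ ∣⇒≤ , m≤n⇒m≤1+n ∘′ prime∣primorial⇒≤ n pr ]′ (euclidsLemma (suc n) (primorial n) pr p∣P)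
... | no  _ = m≤n⇒m≤1+n (prime∣primorial⇒≤ n pr (subst (p ∣_) (+-identityʳ _) p∣P))

-- A new prime n + 1 divides M * primorial q = c * primorial n, but not primorial n, whose prime
-- factors are at most n; hence it divides the cofactor c.
primorial-∣ : ∀ {M q} → q ≤′ n → (∀ {p} → Prime p → q < p → p ≤ n → p ∣ M) → primorial n ∣ M * primorial q
primorial-∣ {M = M} ≤′-refl _ = n∣m*n M
primorial-∣ {suc n} {M} {q} (≤′-step q≤n) p∣M
  with divides c eq ← primorial-∣ q≤n (λ pr q<p p≤n → p∣M pr q<p (m≤n⇒m≤1+n p≤n)) | prime? (suc n)
... | no ¬pr = subst (_∣ M * primorial q) (sym (+-identityʳ _)) (divides c eq)
... | yes pr = subst (suc n * primorial n ∣_) (sym eq) (*-monoˡ-∣ (primorial n)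
  ([ id , (λ 1+n∣P → contradiction (prime∣primorial⇒≤ n pr 1+n∣P) 1+n≰n) ]′
    (euclidsLemma c (primorial n) pr (subst (suc n ∣_) eq
      (∣m⇒∣m*n (primorial q) (p∣M pr (s≤s (≤′⇒≤ q≤n)) ≤-refl))))))

-- Powers, and weighted binomial and multinomial inequalities

^-distribʳ-* : ∀ m n o → (m * n) ^ o ≡ m ^ o * n ^ o
^-distribʳ-* m n zero    = refl
^-distribʳ-* m n (suc o) = trans (cong (m * n *_) (^-distribʳ-* m n o)) (interchange m n (m ^ o) (n ^ o))
  where
  interchange : ∀ a b c d → a * b * (c * d) ≡ a * c * (b * d)
  interchange = solve-∀

^-comm : ∀ m n o → (m ^ n) ^ o ≡ (m ^ o) ^ n
^-comm m n o = trans (^-*-assoc m n o) (trans (cong (m ^_) (*-comm n o)) (sym (^-*-assoc m o n)))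

^-cancelˡ-≤ : ∀ o .{{_ : NonZero o}} → m ^ o ≤ n ^ o → m ≤ n
^-cancelˡ-≤ o m^o≤n^o = ≮⇒≥ λ n<m → <⇒≱ (^-monoˡ-< o n<m) m^o≤n^o

^-cancelʳ-≤ : 1 < m → ∀ {a b} → m ^ a ≤ m ^ b → a ≤ b
^-cancelʳ-≤ {m} 1<m m^a≤m^b = ≮⇒≥ λ b<a → <⇒≱ (^-monoʳ-< m 1<m b<a) m^a≤m^b

-- One term of the expansion of (x + y)^(a+b), with the factorials cleared. The induction is
-- Pascal's rule: the leading factor a + b + 2 splits as (a + 1) + (b + 1).
binomial-weight : ∀ a b x y → (a + b) ! * (x ^ a * y ^ b) ≤ (x + y) ^ (a + b) * (a ! * b !)
binomial-weight zero b x y = begin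
  b ! * (1 * y ^ b)          ≡⟨ cong (b ! *_) (*-identityˡ _) ⟩
  b ! * y ^ b                ≤⟨ *-monoʳ-≤ (b !) (^-monoˡ-≤ b (m≤n+m y x)) ⟩
  b ! * (x + y) ^ b          ≡⟨ *-comm (b !) _ ⟩
  (x + y) ^ b * b !          ≡⟨ cong ((x + y) ^ b *_) (*-identityˡ _) ⟨
  (x + y) ^ b * (1 * b !)    ∎
  where open ≤-Reasoning
binomial-weight (suc a) zero x y = begin
  suc (a + 0) ! * (x ^ suc a * 1)      ≡⟨ cong₂ _*_ (cong (λ k → suc k !) (+-identityʳ a)) (*-identityʳ _) ⟩
  suc a ! * x ^ suc a                  ≤⟨ *-monoʳ-≤ (suc a !) (^-monoˡ-≤ (suc a) (m≤m+n x y)) ⟩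
  suc a ! * (x + y) ^ suc a            ≡⟨ *-comm (suc a !) _ ⟩
  (x + y) ^ suc a * suc a !
    ≡⟨ cong₂ _*_ (cong (λ k → (x + y) ^ suc k) (+-identityʳ a)) (*-identityʳ _) ⟨
  (x + y) ^ suc (a + 0) * (suc a ! * 1) ∎
  where open ≤-Reasoning
binomial-weight (suc a) (suc b) x y = begin
  suc (a + suc b) * f * (x * X * (y * Y))
    ≡⟨ cong (λ k → suc k * f * (x * X * (y * Y))) (+-suc a b) ⟩
  suc (suc (a + b)) * f * (x * X * (y * Y))
    ≡⟨ split a b f x X y Y ⟩
  suc a * x * (f * (X * (y * Y))) + suc b * y * (f * (x * X * Y))
    ≤⟨ +-mono-≤ (*-monoʳ-≤ (suc a * x) (binomial-weight a (suc b) x y)) (*-monoʳ-≤ (suc b * y) ih) ⟩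
  suc a * x * (z * (a ! * (suc b * b !))) + suc b * y * (z * (suc a * a ! * b !))
    ≡⟨ join (suc a) (suc b) x y z (a !) (b !) ⟩
  (x + y) * z * (suc a * a ! * (suc b * b !))   ∎
  where
  open ≤-Reasoning
  f = (a + suc b) !
  X = x ^ a
  Y = y ^ b
  z = (x + y) ^ (a + suc b)
  ih : f * (x * X * Y) ≤ z * (suc a * a ! * b !)
  ih = subst (λ k → k ! * (x * X * Y) ≤ (x + y) ^ k * (suc a * a ! * b !)) (sym (+-suc a b)) (binomial-weight (suc a) b x y)
  split : ∀ a b f x X y Y → suc (suc (a + b)) * f * (x * X * (y * Y)) ≡
          suc a * x * (f * (X * (y * Y))) + suc b * y * (f * (x * X * Y))
  split = solve-∀
  join : ∀ a b x y z f g → a * x * (z * (f * (b * g))) + b * y * (z * (a * f * g)) ≡ (x + y) * z * (a * f * (b * g))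
  join = solve-∀

∏^ : List (ℕ × ℕ) → ℕ
∏^ kws = product (map (λ (k , w) → w ^ k) kws)

multinomial-weight : ∀ kws → sum (map proj₁ kws) ! * ∏^ kws ≤ sum (map proj₂ kws) ^ sum (map proj₁ kws) * ∏! (map proj₁ kws)
multinomial-weight [] = ≤-refl
multinomial-weight ((k , w) ∷ kws)
  with sum (map proj₂ kws) ^ sum (map proj₁ kws) in v^s≡
-- Here v^s = 0 cannot be cancelled. The induction hypothesis then forces `∏^ kws` to be 0, so the
-- left side vanishes.
... | zero  = ≤-trans (≤-reflexive (trans (cong (λ z → (k + s) ! * (w ^ k * z)) ∏^≡0) (vanish ((k + s) !) (w ^ k)))) z≤n
  where
  s = sum (map proj₁ kws)
  vanish : ∀ a b → a * (b * 0) ≡ 0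
  vanish = solve-∀
  ∏^≡0 : ∏^ kws ≡ 0
  ∏^≡0 = m*n≡0⇒m≡0 _ _ {{s !≢0}} (trans (*-comm (∏^ kws) (s !))
    (n≤0⇒n≡0 (subst (λ z → s ! * ∏^ kws ≤ z * ∏! (map proj₁ kws)) v^s≡ (multinomial-weight kws))))
... | suc _ = *-cancelʳ-≤ _ _ (s ! * v ^ s) {{m*n≢0 (s !) (v ^ s) {{s !≢0}} {{v^s≢0}}}} (begin
  (k + s) ! * (w ^ k * ∏^ kws) * (s ! * v ^ s)      ≡⟨ rearrange₁ ((k + s) !) (w ^ k) (∏^ kws) (s !) (v ^ s) ⟩
  (k + s) ! * (w ^ k * v ^ s) * (s ! * ∏^ kws)
    ≤⟨ *-mono-≤ (binomial-weight k s w v) (multinomial-weight kws) ⟩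
  (w + v) ^ (k + s) * (k ! * s !) * (v ^ s * ∏! ks) ≡⟨ rearrange₂ ((w + v) ^ (k + s)) (k !) (s !) (v ^ s) (∏! ks) ⟩
  (w + v) ^ (k + s) * (k ! * ∏! ks) * (s ! * v ^ s) ∎)
  where
  open ≤-Reasoning
  ks = map proj₁ kws
  s = sum ks
  v = sum (map proj₂ kws)
  v^s≢0 : NonZero (v ^ s)
  v^s≢0 = subst NonZero (sym v^s≡) _
  rearrange₁ : ∀ a b c d e → a * (b * c) * (d * e) ≡ a * (b * e) * (d * c)
  rearrange₁ = solve-∀
  rearrange₂ : ∀ a b c d e → a * (b * c) * (d * e) ≡ a * (b * e) * (c * d)
  rearrange₂ = solve-∀

-- Multinomial coefficients with parts ⌊n / a⌋, where ∑ 1/a = 1 and one of the a is their common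
-- multiple W = suc V.  The entry (a , w) of qs stands for the divisor suc a = W / w.
module Hanson (V : ℕ) (qs : List (ℕ × ℕ)) (aw≡W : All (λ (a , w) → suc a * w ≡ suc V) qs)
              (∑w≡V : sum (map proj₂ qs) ≡ V) where

  W : ℕ
  W = suc V

  parts : ℕ → List (ℕ × ℕ) → List ℕ
  parts n = map (λ (a , _) → n / suc a)

  ks : ℕ → List ℕ
  ks n = n / W ∷ parts n qs

  ∑w : List (ℕ × ℕ) → ℕ
  ∑w qs = sum (map proj₂ qs)

  ∑parts-upper : ∀ n {qs} → All (λ (a , w) → suc a * w ≡ W) qs → sum (parts n qs) * W ≤ n * ∑w qs
  ∑parts-upper n []                   = z≤n
  ∑parts-upper n {(a , w) ∷ qs} (aw≡ ∷ aws≡) = begin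
    (k + sum (parts n qs)) * W       ≡⟨ *-distribʳ-+ W k _ ⟩
    k * W + sum (parts n qs) * W     ≤⟨ +-mono-≤ kW≤nw (∑parts-upper n aws≡) ⟩
    n * w + n * ∑w qs                ≡⟨ *-distribˡ-+ n w _ ⟨
    n * (w + ∑w qs)                  ∎
    where
    open ≤-Reasoning
    k = n / suc a
    kW≤nw : k * W ≤ n * w
    kW≤nw = begin
      k * W            ≡⟨ cong (k *_) aw≡ ⟨
      k * (suc a * w)  ≡⟨ *-assoc k (suc a) w ⟨
      k * suc a * w    ≤⟨ *-monoˡ-≤ w (m/n*n≤m n (suc a)) ⟩
      n * w            ∎

  ∑parts-lower : ∀ n {qs} → All (λ (a , w) → suc a * w ≡ W) qs → suc n * ∑w qs ≤ (sum (parts n qs) + length qs) * W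
  ∑parts-lower n []                   = ≤-reflexive (*-zeroʳ n)
  ∑parts-lower n {(a , w) ∷ qs} (aw≡ ∷ aws≡) = begin
    suc n * (w + ∑w qs)                                  ≡⟨ *-distribˡ-+ (suc n) w _ ⟩
    suc n * w + suc n * ∑w qs                            ≤⟨ +-mono-≤ nw≤ (∑parts-lower n aws≡) ⟩
    suc k * W + (sum (parts n qs) + length qs) * W       ≡⟨ rearrange k (sum (parts n qs)) (length qs) W ⟩
    (k + sum (parts n qs) + suc (length qs)) * W         ∎
    where
    open ≤-Reasoning
    k = n / suc a
    rearrange : ∀ k s l W → suc k * W + (s + l) * W ≡ (k + s + suc l) * W
    rearrange = solve-∀
    nw≤ : suc n * w ≤ suc k * W
    nw≤ = begin
      suc n * w            ≤⟨ *-monoˡ-≤ w (n<[1+n/p]*p n (suc a)) ⟩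
      suc k * suc a * w    ≡⟨ *-assoc (suc k) (suc a) w ⟩
      suc k * (suc a * w)  ≡⟨ cong (suc k *_) aw≡ ⟩
      suc k * W            ∎

  ∑ks≤n : ∀ n → sum (ks n) ≤ n
  ∑ks≤n n = *-cancelʳ-≤ _ _ W (begin
    (n / W + sum (parts n qs)) * W        ≡⟨ *-distribʳ-+ W (n / W) _ ⟩
    n / W * W + sum (parts n qs) * W      ≤⟨ +-mono-≤ (m/n*n≤m n W) (∑parts-upper n aw≡W) ⟩
    n + n * ∑w qs                         ≡⟨ cong (λ v → n + n * v) ∑w≡V ⟩
    n + n * V                             ≡⟨ *-suc n V ⟨
    n * W                                 ∎)
    where open ≤-Reasoning

  -- Each of the `length qs` + 1 floors loses less than 1, so the integer total lost is at most
  -- `length qs`. The form n + 1 ≤ (k + 1)a of each estimate captures this.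
  n≤∑ks+length : ∀ n → n ≤ sum (ks n) + length qs
  n≤∑ks+length n = ≤-pred (*-cancelʳ-≤ _ _ W (begin
    suc n * W                                                   ≡⟨ *-suc (suc n) V ⟩
    suc n + suc n * V                                           ≡⟨ cong (λ v → suc n + suc n * v) ∑w≡V ⟨
    suc n + suc n * ∑w qs
      ≤⟨ +-mono-≤ (n<[1+n/p]*p n W) (∑parts-lower n aw≡W) ⟩
    suc (n / W) * W + (sum (parts n qs) + length qs) * W        ≡⟨ *-distribʳ-+ W (suc (n / W)) _ ⟨
    (suc (n / W) + (sum (parts n qs) + length qs)) * W          ≡⟨ cong (λ k → suc k * W) (+-assoc (n / W) _ _) ⟨
    suc (sum (ks n) + length qs) * W                            ∎))
    where open ≤-Reasoning

  -- What the floors lose. As an extra part it makes the parts sum to exactly n, so that `c` is a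
  -- genuine multinomial coefficient and `M` differs from it only by the factor r!.
  r : ℕ → ℕ
  r n = n ∸ sum (ks n)

  r+∑ks≡n : ∀ n → r n + sum (ks n) ≡ n
  r+∑ks≡n n = m∸n+n≡m (∑ks≤n n)

  r≤length : ∀ n → r n ≤ length qs
  r≤length n = m≤n+o⇒m∸n≤o n (sum (ks n)) (n≤∑ks+length n)

  c∣ : ∀ n → ∏! (r n ∷ ks n) ∣ n !
  c∣ n = subst (λ k → ∏! (r n ∷ ks n) ∣ k !) (r+∑ks≡n n) (∏!∣sum! (r n ∷ ks n))

  c : ℕ → ℕ
  c n = quotient (c∣ n)

  M : ℕ → ℕ
  M n = c n * r n !

  M*∏!≡ : ∀ n → M n * ∏! (ks n) ≡ n !
  M*∏!≡ n = trans (*-assoc (c n) (r n !) (∏! (ks n))) (sym (_∣_.equality (c∣ n)))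

  parts/p : ∀ n p .{{_ : NonZero p}} qs → map (_/ p) (parts n qs) ≡ parts (n / p) qs
  parts/p n p []             = refl
  parts/p n p ((a , w) ∷ qs) = cong₂ _∷_ swap (parts/p n p qs)
    where
    instance
      _ = m*n≢0 p (suc a)
    swap : n / suc a / p ≡ n / p / suc a
    swap = trans (m/n/o≡m/[n*o] n (suc a) p {{_}} {{_}} {{m*n≢0 (suc a) p}})
      (trans (/-congʳ {{m*n≢0 (suc a) p}} (*-comm (suc a) p)) (sym (m/n/o≡m/[n*o] n p (suc a))))

  -- There is no multiple of p up to n/W, and the other parts contain at most N(1 - 1/W) < N of
  -- them, where N = n/p ≥ 1 counts those up to n.
  prime∣M : ∀ n {p} → Prime p → n / W < p → p ≤ n → p ∣ M n
  prime∣M n {p} pr q<p p≤n = ∣-multinomial pr (ks n) n (M*∏!≡ n) (*-cancelʳ-< _ _ _ (begin-strict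
    (n / W / p + sum (map (_/ p) (parts n qs))) * W
      ≡⟨ cong₂ (λ k l → (k + sum l) * W) (m<n⇒m/n≡0 q<p) (parts/p n p qs) ⟩
    sum (parts N qs) * W                             ≤⟨ ∑parts-upper N aw≡W ⟩
    N * ∑w qs                                        ≡⟨ cong (N *_) ∑w≡V ⟩
    N * V                                            <⟨ m<n+m (N * V) (m≥n⇒m/n>0 p≤n) ⟩
    N + N * V                                        ≡⟨ *-suc N V ⟨
    N * W                                            ∎))
    where
    open ≤-Reasoning
    instance _ = prime⇒nonZero pr
    N = n / p

  primorial≤ : ∀ n → primorial n ≤ M n * primorial (n / W)
  primorial≤ n = ∣⇒≤ {{m*n≢0 (M n) _ {{M≢0}} {{>-nonZero (primorial>0 (n / W))}}}}
    (primorial-∣ (≤⇒≤′ (m/n≤m n W)) (prime∣M n))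
    where
    M≢0 : NonZero (M n)
    M≢0 = m*n≢0⇒m≢0 (M n) {∏! (ks n)} {{subst NonZero (sym (M*∏!≡ n)) (n !≢0)}}

  weighted : ℕ → List (ℕ × ℕ) → List (ℕ × ℕ)
  weighted n = map (λ (a , w) → n / suc a , w)

  -- The normalised weights are w/W = 1/a for the divisor a, and `A` clears them. `Γ` is the product
  -- of a^(W/a), so `A` is at most Γ^(n/W).
  A : ℕ → List (ℕ × ℕ) → ℕ
  A n qs = product (map (λ (a , w) → suc a ^ (n / suc a)) qs)

  Γ : List (ℕ × ℕ) → ℕ
  Γ qs = product (map (λ (a , w) → suc a ^ w) qs)

  ∏^*A≡W^∑ : ∀ n {qs} → All (λ (a , w) → suc a * w ≡ W) qs → ∏^ (weighted n qs) * A n qs ≡ W ^ sum (parts n qs)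
  ∏^*A≡W^∑ n [] = refl
  ∏^*A≡W^∑ n {(a , w) ∷ qs} (aw≡ ∷ aws≡) = begin-equality
    w ^ k * ∏^ (weighted n qs) * (suc a ^ k * A n qs)
      ≡⟨ interchange (w ^ k) (∏^ (weighted n qs)) (suc a ^ k) (A n qs) ⟩
    suc a ^ k * w ^ k * (∏^ (weighted n qs) * A n qs)
      ≡⟨ cong₂ _*_ (sym (^-distribʳ-* (suc a) w k)) (∏^*A≡W^∑ n aws≡) ⟩
    (suc a * w) ^ k * W ^ sum (parts n qs)              ≡⟨ cong (λ z → z ^ k * W ^ sum (parts n qs)) aw≡ ⟩
    W ^ k * W ^ sum (parts n qs)                        ≡⟨ ^-distribˡ-+-* W k _ ⟨
    W ^ (k + sum (parts n qs))                          ∎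
    where
    open ≤-Reasoning
    k = n / suc a
    interchange : ∀ a b c d → a * b * (c * d) ≡ c * a * (b * d)
    interchange = solve-∀

  A^W≤Γ^n : ∀ n {qs} → All (λ (a , w) → suc a * w ≡ W) qs → A n qs ^ W ≤ Γ qs ^ n
  A^W≤Γ^n n [] = ≤-reflexive (trans (^-zeroˡ W) (sym (^-zeroˡ n)))
  A^W≤Γ^n n {(a , w) ∷ qs} (aw≡ ∷ aws≡) = begin
    (suc a ^ k * A n qs) ^ W            ≡⟨ ^-distribʳ-* (suc a ^ k) (A n qs) W ⟩
    (suc a ^ k) ^ W * A n qs ^ W        ≤⟨ *-mono-≤ head (A^W≤Γ^n n aws≡) ⟩
    (suc a ^ w) ^ n * Γ qs ^ n          ≡⟨ ^-distribʳ-* (suc a ^ w) (Γ qs) n ⟨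
    (suc a ^ w * Γ qs) ^ n              ∎
    where
    open ≤-Reasoning
    k = n / suc a
    head : (suc a ^ k) ^ W ≤ (suc a ^ w) ^ n
    head = begin
      (suc a ^ k) ^ W            ≡⟨ ^-*-assoc (suc a) k W ⟩
      suc a ^ (k * W)            ≡⟨ cong (λ z → suc a ^ (k * z)) aw≡ ⟨
      suc a ^ (k * (suc a * w))  ≡⟨ cong (suc a ^_) (*-assoc k (suc a) w) ⟨
      suc a ^ (k * suc a * w)    ≤⟨ ^-monoʳ-≤ (suc a) (*-monoˡ-≤ w (m/n*n≤m n (suc a))) ⟩
      suc a ^ (n * w)            ≡⟨ cong (suc a ^_) (*-comm n w) ⟩
      suc a ^ (w * n)            ≡⟨ ^-*-assoc (suc a) w n ⟨
      (suc a ^ w) ^ n            ∎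

  -- The part n/W and the remainder r both get weight 1. The weights then sum to W + 1 instead of W,
  -- at the price of a factor (1 + 1/W)^n.
  c*∏^≤ : ∀ n → c n * ∏^ (weighted n qs) ≤ suc W ^ n
  c*∏^≤ n = *-cancelʳ-≤ _ _ (∏! (r n ∷ ks n)) {{∏!-nonZero (r n ∷ ks n)}} (begin
    c n * Π * ∏! (r n ∷ ks n)                        ≡⟨ rearrange (c n) Π (∏! (r n ∷ ks n)) ⟩
    c n * ∏! (r n ∷ ks n) * Π
      ≡⟨ cong₂ (λ x y → x * y) (sym (_∣_.equality (c∣ n))) (sym Π≡) ⟩
    n ! * ∏^ kws                                     ≡⟨ cong (λ k → k ! * ∏^ kws) ∑k≡n ⟨
    sum (map proj₁ kws) ! * ∏^ kws                   ≤⟨ multinomial-weight kws ⟩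
    sum (map proj₂ kws) ^ sum (map proj₁ kws) * ∏! (map proj₁ kws)
      ≡⟨ cong₂ _*_ (cong₂ _^_ ∑w≡ ∑k≡n) (cong ∏! k≡) ⟩
    suc W ^ n * ∏! (r n ∷ ks n)                      ∎)
    where
    open ≤-Reasoning
    Π = ∏^ (weighted n qs)
    kws = (r n , 1) ∷ (n / W , 1) ∷ weighted n qs
    k≡ : map proj₁ kws ≡ r n ∷ ks n
    k≡ = cong (λ l → r n ∷ n / W ∷ l) (sym (map-∘ qs))
    ∑k≡n : sum (map proj₁ kws) ≡ n
    ∑k≡n = trans (cong sum k≡) (r+∑ks≡n n)
    ∑w≡ : sum (map proj₂ kws) ≡ suc W
    ∑w≡ = cong (2 +_) (trans (cong sum (sym (map-∘ qs))) ∑w≡V)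
    Π≡ : ∏^ kws ≡ Π
    Π≡ = trans (cong₂ (λ x y → x * (y * Π)) (^-zeroˡ (r n)) (^-zeroˡ (n / W))) (trans (*-identityˡ _) (*-identityˡ Π))
    rearrange : ∀ a b c → a * b * c ≡ a * c * b
    rearrange = solve-∀

  c*W^n≤ : ∀ n → c n * W ^ n ≤ suc W ^ n * A n qs * W ^ (n / W) * W ^ r n
  c*W^n≤ n = begin
    c n * W ^ n                                                    ≡⟨ cong (λ k → c n * W ^ k) (r+∑ks≡n n) ⟨
    c n * W ^ (r n + (n / W + s))
      ≡⟨ cong (c n *_) (trans (^-distribˡ-+-* W (r n) _) (cong (W ^ r n *_) (^-distribˡ-+-* W (n / W) s))) ⟩
    c n * (W ^ r n * (W ^ (n / W) * W ^ s))
      ≡⟨ cong (λ z → c n * (W ^ r n * (W ^ (n / W) * z))) (∏^*A≡W^∑ n aw≡W) ⟨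
    c n * (W ^ r n * (W ^ (n / W) * (∏^ (weighted n qs) * A n qs)))
      ≡⟨ rearrange (c n) (W ^ r n) (W ^ (n / W)) (∏^ (weighted n qs)) (A n qs) ⟩
    c n * ∏^ (weighted n qs) * A n qs * W ^ (n / W) * W ^ r n
      ≤⟨ *-monoˡ-≤ (W ^ r n) (*-monoˡ-≤ (W ^ (n / W)) (*-monoˡ-≤ (A n qs) (c*∏^≤ n))) ⟩
    suc W ^ n * A n qs * W ^ (n / W) * W ^ r n                     ∎
    where
    open ≤-Reasoning
    s = sum (parts n qs)
    rearrange : ∀ c x y p a → c * (x * (y * (p * a))) ≡ c * p * a * y * x
    rearrange = solve-∀

  -- `growth` reads (1 + 1/W)^W ∏ a^(W/a) ≤ 2^b, the product including a = W: apart from the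
  -- remainder, `c` grows by at most b/W bits per unit of n. `remainder` bounds W^r r! at the
  -- largest possible r.
  module _ (b e : ℕ) (growth : suc W ^ W * (Γ qs * W) ≤ 2 ^ b * W ^ W)
           (remainder : W ^ length qs * length qs ! ≤ 2 ^ e) where

    c^W≤ : ∀ n → c n ^ W ≤ (2 ^ b) ^ n * (W ^ r n) ^ W
    c^W≤ n = *-cancelʳ-≤ _ _ ((W ^ W) ^ n) {{m^n≢0 (W ^ W) n {{m^n≢0 W W}}}} (begin
      c n ^ W * (W ^ W) ^ n                                     ≡⟨ cong (c n ^ W *_) (^-comm W W n) ⟩
      c n ^ W * (W ^ n) ^ W                                     ≡⟨ ^-distribʳ-* (c n) (W ^ n) W ⟨
      (c n * W ^ n) ^ W                                         ≤⟨ ^-monoˡ-≤ W (c*W^n≤ n) ⟩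
      (suc W ^ n * A n qs * W ^ (n / W) * W ^ r n) ^ W
        ≡⟨ trans (^-distribʳ-* (suc W ^ n * A n qs * W ^ (n / W)) (W ^ r n) W)
            (cong (_* ρ) (trans (^-distribʳ-* (suc W ^ n * A n qs) (W ^ (n / W)) W)
                (cong (_* (W ^ (n / W)) ^ W) (^-distribʳ-* (suc W ^ n) (A n qs) W)))) ⟩
      (suc W ^ n) ^ W * A n qs ^ W * (W ^ (n / W)) ^ W * ρ
        ≤⟨ *-monoˡ-≤ ρ (*-mono-≤ (*-mono-≤ (≤-reflexive (^-comm (suc W) n W)) (A^W≤Γ^n n aw≡W)) W^≤) ⟩
      (suc W ^ W) ^ n * Γ qs ^ n * W ^ n * ρ
        ≡⟨ cong (_* ρ) (trans (*-assoc ((suc W ^ W) ^ n) (Γ qs ^ n) (W ^ n))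
            (trans (cong ((suc W ^ W) ^ n *_) (sym (^-distribʳ-* (Γ qs) W n)))
                (sym (^-distribʳ-* (suc W ^ W) (Γ qs * W) n)))) ⟩
      (suc W ^ W * (Γ qs * W)) ^ n * ρ                          ≤⟨ *-monoˡ-≤ ρ (^-monoˡ-≤ n growth) ⟩
      (2 ^ b * W ^ W) ^ n * ρ                                   ≡⟨ cong (_* ρ) (^-distribʳ-* (2 ^ b) (W ^ W) n) ⟩
      (2 ^ b) ^ n * (W ^ W) ^ n * ρ                             ≡⟨ rearrange ((2 ^ b) ^ n) ((W ^ W) ^ n) ρ ⟩
      (2 ^ b) ^ n * ρ * (W ^ W) ^ n                             ∎)
      where
      open ≤-Reasoning
      ρ = (W ^ r n) ^ W
      W^≤ : (W ^ (n / W)) ^ W ≤ W ^ n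
      W^≤ = ≤-trans (≤-reflexive (^-*-assoc W (n / W) W)) (^-monoʳ-≤ W (m/n*n≤m n W))
      rearrange : ∀ a b c → a * b * c ≡ a * c * b
      rearrange = solve-∀

    M^W≤ : ∀ n → M n ^ W ≤ 2 ^ (b * n + e * W)
    M^W≤ n = begin
      (c n * r n !) ^ W                          ≡⟨ ^-distribʳ-* (c n) (r n !) W ⟩
      c n ^ W * (r n !) ^ W                      ≤⟨ *-monoˡ-≤ ((r n !) ^ W) (c^W≤ n) ⟩
      (2 ^ b) ^ n * (W ^ r n) ^ W * (r n !) ^ W  ≡⟨ *-assoc ((2 ^ b) ^ n) _ _ ⟩
      (2 ^ b) ^ n * ((W ^ r n) ^ W * (r n !) ^ W) ≡⟨ cong ((2 ^ b) ^ n *_) (^-distribʳ-* (W ^ r n) (r n !) W) ⟨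
      (2 ^ b) ^ n * (W ^ r n * r n !) ^ W        ≤⟨ *-monoʳ-≤ ((2 ^ b) ^ n) (^-monoˡ-≤ W (≤-trans r≤ remainder)) ⟩
      (2 ^ b) ^ n * (2 ^ e) ^ W                  ≡⟨ cong₂ _*_ (^-*-assoc 2 b n) (^-*-assoc 2 e W) ⟩
      2 ^ (b * n) * 2 ^ (e * W)                  ≡⟨ ^-distribˡ-+-* 2 (b * n) (e * W) ⟨
      2 ^ (b * n + e * W)                        ∎
      where
      open ≤-Reasoning
      r≤ : W ^ r n * r n ! ≤ W ^ length qs * length qs !
      r≤ = *-mono-≤ (^-monoʳ-≤ W (r≤length n)) (∣⇒≤ {{length qs !≢0}} (!-mono-∣ (r≤length n)))

    -- For the 7th power, `M` costs 7b/W bits per unit of n and the recursion to n/W another 11/W;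
    -- `rate` leaves s/W out of 11. Once n ≥ 4W this slack pays for the constant 7e by `absorb`, so
    -- d does not grow with the depth. With s = 101, as used below, `rate` is an equality.
    module _ (s d : ℕ) (1<W : 1 < W) (rate : b * 7 + 11 + s ≤ 11 * W) (absorb : e * 7 ≤ s * 4) (small : e * 7 + 19 ≤ d) where

      primorial^7≤-step : ∀ n t → primorial (n / W) ^ 7 ≤ 2 ^ t → (b * n + e * W) * 7 + t * W ≤ (n * 11 + d) * W →
                          primorial n ^ 7 ≤ 2 ^ (n * 11 + d)
      primorial^7≤-step n t P≤ exponent≤ = ^-cancelˡ-≤ W (begin
        (primorial n ^ 7) ^ W                          ≤⟨ ^-monoˡ-≤ W (^-monoˡ-≤ 7 (primorial≤ n)) ⟩
        ((M n * P) ^ 7) ^ W                            ≡⟨ cong (_^ W) (^-distribʳ-* (M n) P 7) ⟩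
        (M n ^ 7 * P ^ 7) ^ W                          ≡⟨ ^-distribʳ-* (M n ^ 7) (P ^ 7) W ⟩
        (M n ^ 7) ^ W * (P ^ 7) ^ W                    ≡⟨ cong (_* (P ^ 7) ^ W) (^-comm (M n) 7 W) ⟩
        (M n ^ W) ^ 7 * (P ^ 7) ^ W                    ≤⟨ *-mono-≤ (^-monoˡ-≤ 7 (M^W≤ n)) (^-monoˡ-≤ W P≤) ⟩
        (2 ^ (b * n + e * W)) ^ 7 * (2 ^ t) ^ W
          ≡⟨ cong₂ _*_ (^-*-assoc 2 (b * n + e * W) 7) (^-*-assoc 2 t W) ⟩
        2 ^ ((b * n + e * W) * 7) * 2 ^ (t * W)        ≡⟨ ^-distribˡ-+-* 2 ((b * n + e * W) * 7) (t * W) ⟨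
        2 ^ ((b * n + e * W) * 7 + t * W)              ≤⟨ ^-monoʳ-≤ 2 exponent≤ ⟩
        2 ^ ((n * 11 + d) * W)                         ≡⟨ ^-*-assoc 2 (n * 11 + d) W ⟨
        (2 ^ (n * 11 + d)) ^ W                         ∎)
        where
        open ≤-Reasoning
        P = primorial (n / W)

      primorial^7≤ : ∀ n → primorial n ^ 7 ≤ 2 ^ (n * 11 + d)
      primorial^7≤ = <-rec _ λ n rec → case n <? 4 * W of λ
        -- Here n/W ≤ 3, and primorial 3 = 6 with 6^7 ≤ 2^19.
        { (yes n<4W) → primorial^7≤-step n 19
            (≤-trans (^-monoˡ-≤ 7 (primorial-mono {n / W} {3} (≤-pred (m<n*o⇒m/o<n {n = 4} n<4W))))
              (≤ᵇ⇒≤ (primorial 3 ^ 7) (2 ^ 19) _))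
            (begin
              (b * n + e * W) * 7 + 19 * W        ≡⟨ rearrange₁ b n e W ⟩
              b * 7 * n + (e * 7 + 19) * W
                ≤⟨ +-mono-≤ (*-monoˡ-≤ n (≤-trans (m≤m+n (b * 7) 11) (≤-trans (m≤m+n _ s) rate))) (*-monoˡ-≤ W small) ⟩
              11 * W * n + d * W                  ≡⟨ rearrange₂ W n d ⟩
              (n * 11 + d) * W                    ∎)
        ; (no n≮4W) → primorial^7≤-step n (n / W * 11 + d)
            (rec (m/n<m n W {{>-nonZero (≤-trans (s≤s z≤n) (≮⇒≥ n≮4W))}} 1<W))
            (begin
              (b * n + e * W) * 7 + (n / W * 11 + d) * W     ≡⟨ rearrange₃ b n e W (n / W) d ⟩
              b * 7 * n + n / W * W * 11 + e * 7 * W + d * W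
                ≤⟨ +-monoˡ-≤ (d * W) (+-mono-≤ (+-monoʳ-≤ (b * 7 * n) (*-monoˡ-≤ 11 (m/n*n≤m n W))) (*-monoˡ-≤ W absorb)) ⟩
              b * 7 * n + n * 11 + s * 4 * W + d * W
                ≡⟨ cong (λ z → b * 7 * n + n * 11 + z + d * W) (*-assoc s 4 W) ⟩
              b * 7 * n + n * 11 + s * (4 * W) + d * W
                ≤⟨ +-monoˡ-≤ (d * W) (+-monoʳ-≤ (b * 7 * n + n * 11) (*-monoʳ-≤ s (≮⇒≥ n≮4W))) ⟩
              b * 7 * n + n * 11 + s * n + d * W             ≡⟨ cong (_+ d * W) (rearrange₄ b n s) ⟩
              (b * 7 + 11 + s) * n + d * W                   ≤⟨ +-monoˡ-≤ (d * W) (*-monoˡ-≤ n rate) ⟩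
              11 * W * n + d * W                             ≡⟨ rearrange₂ W n d ⟩
              (n * 11 + d) * W                               ∎) }
        where
        open ≤-Reasoning
        rearrange₁ : ∀ b n e W → (b * n + e * W) * 7 + 19 * W ≡ b * 7 * n + (e * 7 + 19) * W
        rearrange₁ = solve-∀
        rearrange₂ : ∀ W n d → 11 * W * n + d * W ≡ (n * 11 + d) * W
        rearrange₂ = solve-∀
        rearrange₃ : ∀ b n e W q d → (b * n + e * W) * 7 + (q * 11 + d) * W ≡ b * 7 * n + q * W * 11 + e * 7 * W + d * W
        rearrange₃ = solve-∀
        rearrange₄ : ∀ b n s → b * 7 * n + n * 11 + s * n ≡ (b * 7 + 11 + s) * n
        rearrange₄ = solve-∀

-- 2822 / 1806 is the growth rate of M in bits, just below 11/7.
primorial^7≤2^[11n+360] : ∀ n → primorial n ^ 7 ≤ 2 ^ (n * 11 + 360)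
primorial^7≤2^[11n+360] =
  Hanson.primorial^7≤ 1805 ((1 , 903) ∷ (2 , 602) ∷ (6 , 258) ∷ (42 , 42) ∷ [])
    (refl ∷ refl ∷ refl ∷ refl ∷ []) refl 2822 48
    (≤ᵇ⇒≤ (1807 ^ 1806 * (2 ^ 903 * (3 ^ 602 * (7 ^ 258 * (43 ^ 42 * 1))) * 1806)) (2 ^ 2822 * 1806 ^ 1806) _)
    (≤ᵇ⇒≤ (1806 ^ 4 * 24) (2 ^ 48) _) 101 360
    (≤ᵇ⇒≤ 2 1806 _) (≤ᵇ⇒≤ 19866 19866 _) (≤ᵇ⇒≤ 336 404 _) (≤ᵇ⇒≤ 355 360 _)

-- A linear bound for π

log₂ : ∀ n → ∃[ L ] 2 ^ L ≤ suc n × suc n < 2 ^ suc L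
log₂ zero = 0 , ≤-refl , ≤-refl
log₂ (suc n) with L , lo , hi ← log₂ n with suc (suc n) <? 2 ^ suc L
... | yes lt = L , m≤n⇒m≤1+n lo , lt
... | no ≮   = suc L , ≮⇒≥ ≮ , ≤-<-trans hi (^-monoʳ-< 2 ≤-refl (n<1+n (suc L)))

√ : ∀ n → ∃[ s ] s * s ≤ n × n < suc s * suc s
√ zero = 0 , z≤n , ≤-refl
√ (suc n) with s , lo , hi ← √ n with suc n <? suc s * suc s
... | yes lt = s , m≤n⇒m≤1+n lo , lt
... | no ≮   = suc s , ≮⇒≥ ≮ , ≤-<-trans hi (*-mono-< (n<1+n (suc s)) (n<1+n (suc s)))

-- Every prime p in (h, n] satisfies X ≤ 2(h + 1) ≤ 2p, so X to the number of these primes is at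
-- most the product of the 2p. Both quotients are cross-multiplied.
interval-bound : ∀ X {h n} → h ≤′ n → X ≤ 2 * suc h →
                 X ^ π n * (2 ^ π h * primorial h) ≤ X ^ π h * (2 ^ π n * primorial n)
interval-bound X ≤′-refl _ = ≤-refl
interval-bound X {h} {suc n} (≤′-step h≤n) X≤ with prime? (suc n)
... | no _   = subst (λ z → X ^ π n * (2 ^ π h * primorial h) ≤ X ^ π h * (2 ^ π n * z)) (sym (+-identityʳ _))
                 (interval-bound X h≤n X≤)
... | yes _  = begin
  X * X ^ π n * (2 ^ π h * primorial h)                   ≡⟨ *-assoc X _ _ ⟩
  X * (X ^ π n * (2 ^ π h * primorial h))
    ≤⟨ *-mono-≤ (≤-trans X≤ (*-monoʳ-≤ 2 (s≤s (≤′⇒≤ h≤n)))) (interval-bound X h≤n X≤) ⟩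
  2 * suc n * (X ^ π h * (2 ^ π n * primorial n))         ≡⟨ rearrange (suc n) (X ^ π h) (2 ^ π n) (primorial n) ⟩
  X ^ π h * (2 * 2 ^ π n * (suc n * primorial n))         ∎
  where
  open ≤-Reasoning
  rearrange : ∀ a x y z → 2 * a * (x * (y * z)) ≡ x * (2 * y * (a * z))
  rearrange = solve-∀

dyadic : ℕ → ℕ → ℕ
dyadic zero    n = 0
dyadic (suc k) n = π n + dyadic k (n / 2)

1+n≤2[1+n/2] : ∀ n → suc n ≤ 2 * suc (n / 2)
1+n≤2[1+n/2] n = subst (n <_) (*-comm (suc (n / 2)) 2) (n<[1+n/p]*p n 2)

-- A prime p ≤ n with n / 2ⁱ⁺¹ < p ≤ n / 2ⁱ satisfies n + 1 ≤ 2ⁱ⁺¹ p.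
dyadic-bound : ∀ k n → n < 2 ^ k → suc n ^ π n ≤ 2 ^ dyadic k n * primorial n
dyadic-bound zero    zero    _         = ≤-refl
dyadic-bound zero    (suc n) (s≤s ())
dyadic-bound (suc k) n       n<2^ = *-cancelʳ-≤ _ _ (2 ^ π h * primorial h)
  {{m*n≢0 _ _ {{m^n≢0 2 (π h)}} {{>-nonZero (primorial>0 h)}}}} (begin
    suc n ^ π n * (2 ^ π h * primorial h)
      ≤⟨ interval-bound (suc n) (≤⇒≤′ (m/n≤m n 2)) (1+n≤2[1+n/2] n) ⟩
    suc n ^ π h * (2 ^ π n * primorial n)                   ≤⟨ *-monoˡ-≤ _ (^-monoˡ-≤ (π h) (1+n≤2[1+n/2] n)) ⟩
    (2 * suc h) ^ π h * (2 ^ π n * primorial n)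
      ≡⟨ cong (_* (2 ^ π n * primorial n)) (^-distribʳ-* 2 (suc h) (π h)) ⟩
    2 ^ π h * suc h ^ π h * (2 ^ π n * primorial n)
      ≤⟨ *-monoˡ-≤ _ (*-monoʳ-≤ (2 ^ π h) (dyadic-bound k h h<2^)) ⟩
    2 ^ π h * (2 ^ dyadic k h * primorial h) * (2 ^ π n * primorial n)
      ≡⟨ rearrange (2 ^ π h) (2 ^ dyadic k h) (primorial h) (2 ^ π n) (primorial n) ⟩
    2 ^ π n * 2 ^ dyadic k h * primorial n * (2 ^ π h * primorial h)
      ≡⟨ cong (λ z → z * primorial n * (2 ^ π h * primorial h)) (^-distribˡ-+-* 2 (π n) (dyadic k h)) ⟨
    2 ^ (π n + dyadic k h) * primorial n * (2 ^ π h * primorial h) ∎)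
  where
  open ≤-Reasoning
  h = n / 2
  h<2^ : h < 2 ^ k
  h<2^ = m<n*o⇒m/o<n {n = 2 ^ k} (subst (n <_) (*-comm 2 (2 ^ k)) n<2^)
  rearrange : ∀ a b c d e → a * (b * c) * (d * e) ≡ d * b * e * (a * c)
  rearrange = solve-∀

-- The bit budget allows slopes below 1/9. The constant 2750 reproduces itself in the induction
-- below, so it is dictated by the computed range.
π-Linear : ℕ → Set
π-Linear t = 10 * π t ≤ t + 2750

2*[n/2]≤n : ∀ n → 2 * (n / 2) ≤ n
2*[n/2]≤n n = subst (_≤ n) (*-comm (n / 2) 2) (m/n*n≤m n 2)

dyadic-linear : ∀ k n → (∀ t → t ≤ n → π-Linear t) → 10 * dyadic k n ≤ 2 * n + k * 2750
dyadic-linear zero    n lin = z≤n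
dyadic-linear (suc k) n lin = begin
  10 * (π n + dyadic k h)                  ≡⟨ *-distribˡ-+ 10 (π n) _ ⟩
  10 * π n + 10 * dyadic k h
    ≤⟨ +-mono-≤ (lin n ≤-refl) (dyadic-linear k h λ t t≤h → lin t (≤-trans t≤h (m/n≤m n 2))) ⟩
  n + 2750 + (2 * h + k * 2750)            ≤⟨ +-monoʳ-≤ (n + 2750) (+-monoˡ-≤ (k * 2750) (2*[n/2]≤n n)) ⟩
  n + 2750 + (n + k * 2750)                ≡⟨ rearrange n 2750 (k * 2750) ⟩
  2 * n + suc k * 2750                     ∎
  where
  open ≤-Reasoning
  h = n / 2
  rearrange : ∀ n c d → n + c + (n + d) ≡ 2 * n + (c + d)
  rearrange = solve-∀

log-large : ∀ {L} j → 2 ^ j ≤ n → n < 2 ^ suc L → j ≤ L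
log-large {n} {L} j 2^j≤n n<2^ = ≮⇒≥ λ L<j → <⇒≱ n<2^ (≤-trans (^-monoʳ-≤ 2 {suc L} {j} L<j) 2^j≤n)

-- `dyadic-bound` yields ℓ π(t) ≤ e + (11t + 360)/7, and the hypothesis at t/2 and below bounds e by
-- t/10 plus a multiple of ℓ + 1. Multiplied by 70, the main terms are 117t against 7ℓt; ℓ ≥ 18
-- leaves 9t to absorb the constants.
π-linear-step : ∀ t ℓ → 3000 ≤ t → 18 ≤ ℓ → 2 ^ suc ℓ ≤ t → t < 2 ^ (2 + ℓ) → (∀ u → u < t → π-Linear u) → π-Linear t
π-linear-step t ℓ 3000≤t 18≤ℓ lo hi rec = ≮⇒≥ λ lt → <⇒≱ (contra lt) exponents
  where
  open ≤-Reasoning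
  h = t / 2
  e = dyadic (suc ℓ) h
  h<t : h < t
  h<t = m/n<m t 2 {{>-nonZero (≤-trans (s≤s z≤n) 3000≤t)}} ≤-refl
  powers : 2 ^ ((suc ℓ * π t) * 7) ≤ 2 ^ ((π t + e) * 7 + (t * 11 + 360))
  powers = begin
    2 ^ ((suc ℓ * π t) * 7)                     ≡⟨ ^-*-assoc 2 (suc ℓ * π t) 7 ⟨
    (2 ^ (suc ℓ * π t)) ^ 7                     ≡⟨ cong (_^ 7) (^-*-assoc 2 (suc ℓ) (π t)) ⟨
    ((2 ^ suc ℓ) ^ π t) ^ 7                     ≤⟨ ^-monoˡ-≤ 7 (^-monoˡ-≤ (π t) (m≤n⇒m≤1+n lo)) ⟩
    (suc t ^ π t) ^ 7                           ≤⟨ ^-monoˡ-≤ 7 (dyadic-bound (2 + ℓ) t hi) ⟩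
    (2 ^ (π t + e) * primorial t) ^ 7           ≡⟨ ^-distribʳ-* (2 ^ (π t + e)) (primorial t) 7 ⟩
    (2 ^ (π t + e)) ^ 7 * primorial t ^ 7
      ≤⟨ *-mono-≤ (≤-reflexive (^-*-assoc 2 (π t + e) 7)) (primorial^7≤2^[11n+360] t) ⟩
    2 ^ ((π t + e) * 7) * 2 ^ (t * 11 + 360)    ≡⟨ ^-distribˡ-+-* 2 ((π t + e) * 7) _ ⟨
    2 ^ ((π t + e) * 7 + (t * 11 + 360))        ∎
  10e≤ : 10 * e ≤ t + suc ℓ * 2750
  10e≤ = ≤-trans (dyadic-linear (suc ℓ) h (λ u u≤h → rec u (≤-<-trans u≤h h<t))) (+-monoˡ-≤ (suc ℓ * 2750) (2*[n/2]≤n t))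
  exponents : ℓ * 7 * (10 * π t) ≤ t * 117 + 3600 + suc ℓ * 19250
  exponents = +-cancelˡ-≤ (π t * 7 * 10) _ _ (begin
    π t * 7 * 10 + ℓ * 7 * (10 * π t)                    ≡⟨ left ℓ (π t) ⟩
    suc ℓ * π t * 7 * 10
      ≤⟨ *-monoˡ-≤ 10 (^-cancelʳ-≤ {2} ≤-refl {suc ℓ * π t * 7} {(π t + e) * 7 + (t * 11 + 360)} powers) ⟩
    ((π t + e) * 7 + (t * 11 + 360)) * 10                ≡⟨ right (π t) e t 360 ⟩
    π t * 7 * 10 + (10 * e * 7 + t * 11 * 10 + 360 * 10)
      ≤⟨ +-monoʳ-≤ (π t * 7 * 10) (+-monoˡ-≤ 3600 (+-monoˡ-≤ (t * 11 * 10) (*-monoˡ-≤ 7 10e≤))) ⟩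
    π t * 7 * 10 + ((t + suc ℓ * 2750) * 7 + t * 11 * 10 + 3600)
      ≡⟨ cong (π t * 7 * 10 +_) (regroup t (suc ℓ) 2750 3600) ⟩
    π t * 7 * 10 + (t * 117 + 3600 + suc ℓ * 19250)      ∎)
    where
    left : ∀ i p → p * 7 * 10 + i * 7 * (10 * p) ≡ suc i * p * 7 * 10
    left = solve-∀
    right : ∀ p e t c → ((p + e) * 7 + (t * 11 + c)) * 10 ≡ p * 7 * 10 + (10 * e * 7 + t * 11 * 10 + c * 10)
    right = solve-∀
    regroup : ∀ t l c d → (t + l * c) * 7 + t * 11 * 10 + d ≡ t * 117 + d + l * (c * 7)
    regroup t l c d = trans (collect t l c d 7 110 (t * 11 * 10) (*-assoc t 11 10))
      (cong (λ z → z + d + l * (c * 7)) (sym (*-distribˡ-+ t 7 110)))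
      where
      collect : ∀ t l c d a b z → z ≡ t * b → (t + l * c) * a + z + d ≡ t * a + t * b + d + l * (c * a)
      collect t l c d a b _ refl = collect′ t l c d a b
        where
        collect′ : ∀ t l c d a b → (t + l * c) * a + t * b + d ≡ t * a + t * b + d + l * (c * a)
        collect′ = solve-∀
  contra : t + 2750 < 10 * π t → t * 117 + 3600 + suc ℓ * 19250 < ℓ * 7 * (10 * π t)
  contra lt = begin-strict
    t * 117 + 3600 + (19250 + ℓ * 19250)     ≡⟨ shuffle (t * 117) 3600 19250 (ℓ * 19250) ⟩
    t * 117 + 22850 + ℓ * 19250
      <⟨ +-monoˡ-< (ℓ * 19250) (+-monoʳ-< (t * 117) (<-≤-trans (<ᵇ⇒< 22850 27000 _) (*-monoˡ-≤ 9 3000≤t))) ⟩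
    t * 117 + t * 9 + ℓ * 19250              ≡⟨ cong₂ _+_ (sym (*-distribˡ-+ t 117 9)) (sym (*-assoc ℓ 7 2750)) ⟩
    t * 126 + ℓ * 7 * 2750                   ≡⟨ cong (_+ ℓ * 7 * 2750) (*-comm t 126) ⟩
    18 * 7 * t + ℓ * 7 * 2750                ≤⟨ +-monoˡ-≤ (ℓ * 7 * 2750) (*-monoˡ-≤ t (*-monoˡ-≤ 7 18≤ℓ)) ⟩
    ℓ * 7 * t + ℓ * 7 * 2750                 ≡⟨ *-distribˡ-+ (ℓ * 7) t 2750 ⟨
    ℓ * 7 * (t + 2750)                       ≤⟨ *-monoʳ-≤ (ℓ * 7) (<⇒≤ lt) ⟩
    ℓ * 7 * (10 * π t)                       ∎
    where
    shuffle : ∀ a b c d → a + b + (c + d) ≡ a + (b + c) + d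
    shuffle = solve-∀

π-linear : ∀ N → 3000 ≤ N → 2 ^ 19 ≤ N → (∀ t → t < N → π-Linear t) → ∀ t → π-Linear t
π-linear N 3000≤N 2^19≤N lin = <-rec _ λ t rec → case t <? N of λ
  { (yes t<N) → lin t t<N
  ; (no t≮N)  → large t (≮⇒≥ t≮N) (λ u u<t → rec u<t) }
  where
  large : ∀ t → N ≤ t → (∀ u → u < t → π-Linear u) → π-Linear t
  large zero    N≤t rec = z≤n
  large (suc t) N≤t rec with log₂ t
  ... | zero  , lo , hi = contradiction (log-large {L = 0} 19 (≤-trans 2^19≤N N≤t) hi) λ ()
  ... | suc ℓ , lo , hi = π-linear-step (suc t) ℓ (≤-trans 3000≤N N≤t)
                            (≤-pred (log-large 19 (≤-trans 2^19≤N N≤t) hi)) lo hi rec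

-- Central binomial coefficients

extract : 2 ≤ p → ∀ n → 1 ≤ n → ∃₂ λ k n′ → n ≡ p ^ k * n′ × ¬ p ∣ n′
extract {p} 2≤p = <-rec _ λ n rec 1≤n → case p ∣? n of λ
  { (no ¬p∣n)             → 0 , n , sym (*-identityˡ n) , ¬p∣n
  ; (yes (divides q n≡qp)) → step n q n≡qp 1≤n rec }
  where
  step : ∀ n q → n ≡ q * p → 1 ≤ n → (∀ {i} → i < n → 1 ≤ i → ∃₂ λ k n′ → i ≡ p ^ k * n′ × ¬ p ∣ n′) →
         ∃₂ λ k n′ → n ≡ p ^ k * n′ × ¬ p ∣ n′
  step n zero    refl () rec
  step n (suc q) refl _  rec with k , n′ , eq , ¬p∣n′ ← rec (m<m*n (suc q) p 2≤p) (s≤s z≤n) =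
    suc k , n′ , trans (*-comm (suc q) p) (trans (cong (p *_) eq) (sym (*-assoc p (p ^ k) n′))) , ¬p∣n′

noPrimeDivisor⇒≡1 : ∀ n → 1 ≤ n → (∀ p → Prime p → ¬ p ∣ n) → n ≡ 1
noPrimeDivisor⇒≡1 n 1≤n none with factorise n {{>-nonZero 1≤n}}
... | record { factors = [] ; isFactorisation = eq } = eq
... | record { factors = p ∷ ps ; isFactorisation = eq ; factorsPrime = pr ∷ _ } =
  contradiction (divides (product ps) (trans eq (*-comm p (product ps)))) (none p pr)

-- h y is a budget for the part of N made of primes up to y. The full power of y + 1 is peeled off
-- n, and n ∣ N is carried along so that `gain`, stated for powers dividing N, applies.
bound-by-prime-powers : ∀ (h : ℕ → ℕ) N → 1 ≤ h 0 → (∀ y → h y ≤ h (suc y)) →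
  (∀ y k → Prime (suc y) → suc y ^ k ∣ N → suc y ^ k * h y ≤ h (suc y)) →
  ∀ y n → 1 ≤ n → n ∣ N → (∀ p → Prime p → p ∣ n → p ≤ y) → n ≤ h y
bound-by-prime-powers h N h0 mono gain zero n 1≤n n∣N ≤y = subst (_≤ h 0) (sym n≡1) h0
  where
  n≡1 : n ≡ 1
  n≡1 = noPrimeDivisor⇒≡1 n 1≤n λ p pr p∣n →
    contradiction (≤y p pr p∣n) (<⇒≱ (<-trans z<s (nonTrivial⇒n>1 p {{prime⇒nonTrivial pr}})))
bound-by-prime-powers h N h0 mono gain (suc y) n 1≤n n∣N ≤1+y with prime? (suc y)
... | no ¬pr = ≤-trans (bound-by-prime-powers h N h0 mono gain y n 1≤n n∣N ≤y) (mono y)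
  where
  ≤y : ∀ p → Prime p → p ∣ n → p ≤ y
  ≤y p pr p∣n = ≤-pred (≤∧≢⇒< (≤1+y p pr p∣n) λ { refl → ¬pr pr })
... | yes pr with k , n′ , refl , ¬∣n′ ← extract (nonTrivial⇒n>1 (suc y) {{prime⇒nonTrivial pr}}) n 1≤n =
  ≤-trans (*-monoʳ-≤ (suc y ^ k) (bound-by-prime-powers h N h0 mono gain y n′ 1≤n′
             (∣-trans (n∣m*n (suc y ^ k)) n∣N) ≤y))
          (gain y k pr (∣-trans (m∣m*n n′) n∣N))
  where
  1≤n′ : 1 ≤ n′
  1≤n′ = n≢0⇒n>0 λ { refl → ¬∣n′ (suc y ∣0) }
  ≤y : ∀ p → Prime p → p ∣ n′ → p ≤ y
  ≤y p pr′ p∣n′ = ≤-pred (≤∧≢⇒< (≤1+y p pr′ (∣n⇒∣m*n (suc y ^ k) p∣n′)) λ { refl → ¬∣n′ p∣n′ })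

⊓-suc-≤ : ∀ {y s} → suc y ≤ s → suc y ⊓ s ≡ suc (y ⊓ s)
⊓-suc-≤ y<s = trans (m≤n⇒m⊓n≡m y<s) (cong suc (sym (m≤n⇒m⊓n≡m (≤-trans (n≤1+n _) y<s))))

prime∣!⇒≤ : Prime p → ∀ n → p ∣ n ! → p ≤ n
prime∣!⇒≤ {p} pr n p∣n! = ≮⇒≥ λ n<p → prime∤! pr {{prime⇒nonZero pr}} n<p p∣n!

module CentralBinomial (m C s : ℕ) (C≡ : C * ∏! (m ∷ m ∷ []) ≡ (m + m) !)
                       (1≤m : 1 ≤ m) (2≤s : 2 ≤ s) (X<[1+s]² : m + m < suc s * suc s) where

  X t : ℕ
  X = m + m
  t = X / 3

  instance
    X≢0 : NonZero X
    X≢0 = >-nonZero (≤-trans 1≤m (m≤m+n m m))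

  C≢0 : NonZero C
  C≢0 = m*n≢0⇒m≢0 C {∏! (m ∷ m ∷ [])} {{subst NonZero (sym C≡) (X !≢0)}}

  -- Budgets for primes up to s, up to 2m/3, and above m. `⊓` freezes the first two past their
  -- range, and truncated subtraction keeps the third at 1 up to m. Primes up to s also occur in the
  -- middle factor, which only enlarges the bound.
  h : ℕ → ℕ
  h y = X ^ π (y ⊓ s) * primorial (y ⊓ t) * X ^ (π y ∸ π m)

  *³-mono : ∀ {a a′ b b′ c c′} → a ≤ a′ → b ≤ b′ → c ≤ c′ → a * b * c ≤ a′ * b′ * c′
  *³-mono a b c = *-mono-≤ (*-mono-≤ a b) c

  small-mono : ∀ y → X ^ π (y ⊓ s) ≤ X ^ π (suc y ⊓ s)
  small-mono y = ^-monoʳ-≤ X (π-mono (⊓-monoˡ-≤ s (n≤1+n y)))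

  middle-mono : ∀ y → primorial (y ⊓ t) ≤ primorial (suc y ⊓ t)
  middle-mono y = primorial-mono (⊓-monoˡ-≤ t (n≤1+n y))

  large-mono : ∀ y → X ^ (π y ∸ π m) ≤ X ^ (π (suc y) ∸ π m)
  large-mono y = ^-monoʳ-≤ X (∸-monoˡ-≤ (π m) (π-step y))

  h-mono : ∀ y → h y ≤ h (suc y)
  h-mono y = *³-mono (small-mono y) (middle-mono y) (large-mono y)

  p^k≤X : ∀ {p} k → Prime p → p ^ k ∣ C → p ^ k ≤ X
  p^k≤X k pr = prime-power-∣-binomial pr {{prime⇒nonZero pr}} m m k C≡ (≤-trans 1≤m (m≤m+n m m))

  h-gain : ∀ y k → Prime (suc y) → suc y ^ k ∣ C → suc y ^ k * h y ≤ h (suc y)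
  h-gain y k pr p^k∣C with suc y ≤? s
  ... | yes p≤s = ≤-trans (*-monoˡ-≤ (h y) (p^k≤X k pr p^k∣C)) (begin
    X * (x₁ * x₂ * x₃)                             ≡⟨ rearrange X x₁ x₂ x₃ ⟩
    X ^ suc (π (y ⊓ s)) * x₂ * x₃                  ≡⟨ cong (λ e → X ^ e * x₂ * x₃) π≡ ⟨
    X ^ π (suc y ⊓ s) * x₂ * x₃
      ≤⟨ *³-mono (≤-refl {X ^ π (suc y ⊓ s)}) (middle-mono y) (large-mono y) ⟩
    h (suc y)                                      ∎)
    where
    open ≤-Reasoning
    x₁ = X ^ π (y ⊓ s)
    x₂ = primorial (y ⊓ t)
    x₃ = X ^ (π y ∸ π m)
    π≡ : π (suc y ⊓ s) ≡ suc (π (y ⊓ s))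
    π≡ = trans (cong π (⊓-suc-≤ p≤s)) (π-prime (subst Prime (trans (sym (m≤n⇒m⊓n≡m p≤s)) (⊓-suc-≤ p≤s)) pr))
    rearrange : ∀ X a b c → X * (a * b * c) ≡ X * a * b * c
    rearrange = solve-∀
  ... | no p≰s with suc y ≤? t
  ...   | yes p≤t = ≤-trans (*-monoˡ-≤ (h y) p^k≤p) (begin
    suc y * (x₁ * x₂ * x₃)                         ≡⟨ rearrange (suc y) x₁ x₂ x₃ ⟩
    x₁ * (suc y * x₂) * x₃                         ≡⟨ cong (λ z → x₁ * z * x₃) primorial≡ ⟨
    x₁ * primorial (suc y ⊓ t) * x₃                ≤⟨ *³-mono (small-mono y) ≤-refl (large-mono y) ⟩
    h (suc y)                                      ∎)
    where
    open ≤-Reasoning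
    x₁ = X ^ π (y ⊓ s)
    x₂ = primorial (y ⊓ t)
    x₃ = X ^ (π y ∸ π m)
    s<p : s < suc y
    s<p = ≰⇒> p≰s
    k<2 : k < 2
    k<2 = ≰⇒> λ 2≤k → <⇒≱ X<[1+s]² (begin
      suc s * suc s      ≤⟨ *-mono-≤ s<p s<p ⟩
      suc y * suc y      ≡⟨ cong (suc y *_) (*-identityʳ (suc y)) ⟨
      suc y ^ 2          ≤⟨ ^-monoʳ-≤ (suc y) 2≤k ⟩
      suc y ^ k          ≤⟨ p^k≤X k pr p^k∣C ⟩
      X                  ∎)
    p^k≤p : suc y ^ k ≤ suc y
    p^k≤p = ≤-trans (^-monoʳ-≤ (suc y) (≤-pred k<2)) (≤-reflexive (*-identityʳ (suc y)))
    primorial≡ : primorial (suc y ⊓ t) ≡ suc y * primorial (y ⊓ t)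
    primorial≡ = trans (cong primorial (m≤n⇒m⊓n≡m p≤t)) (trans (primorial-prime pr)
      (cong (λ z → suc y * primorial z) (sym (m≤n⇒m⊓n≡m (≤-trans (n≤1+n y) p≤t)))))
    rearrange : ∀ X a b c → X * (a * b * c) ≡ a * (X * b) * c
    rearrange = solve-∀
  ...   | no p≰t with suc y ≤? m
  ...     | no p≰m = ≤-trans (*-monoˡ-≤ (h y) (p^k≤X k pr p^k∣C)) (begin
    X * (x₁ * x₂ * x₃)                             ≡⟨ rearrange X x₁ x₂ x₃ ⟩
    x₁ * x₂ * X ^ suc (π y ∸ π m)                  ≡⟨ cong (λ e → x₁ * x₂ * X ^ e) π≡ ⟨
    x₁ * x₂ * X ^ (π (suc y) ∸ π m)                ≤⟨ *³-mono (small-mono y) (middle-mono y) ≤-refl ⟩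
    h (suc y)                                      ∎)
    where
    open ≤-Reasoning
    x₁ = X ^ π (y ⊓ s)
    x₂ = primorial (y ⊓ t)
    x₃ = X ^ (π y ∸ π m)
    π≡ : π (suc y) ∸ π m ≡ suc (π y ∸ π m)
    π≡ = trans (cong (_∸ π m) (π-prime pr)) (+-∸-assoc 1 (π-mono (≤-pred (≰⇒> p≰m))))
    rearrange : ∀ X a b c → X * (a * b * c) ≡ a * b * (X * c)
    rearrange = solve-∀
  ...     | yes p≤m with k
  ...       | zero   = ≤-trans (≤-reflexive (*-identityˡ (h y))) (h-mono y)
  -- Here 2m/3 < p ≤ m: there is one multiple of p up to m and there are two up to 2m, and 2 < p
  -- because p > s ≥ 2. All factors p cancel in C.
  ...       | suc k′ = contradiction (∣-trans (m∣m*n (suc y ^ k′)) p^k∣C)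
    (∤-multinomial pr (m ∷ m ∷ []) X C≡ (trans (cong₂ (λ a b → a + (b + 0)) m/p≡1 m/p≡1) (sym X/p≡2))
      (subst (_< suc y) (sym X/p≡2) (≤-trans (s≤s 2≤s) (≰⇒> p≰s))))
    where
    X<3p : X < 3 * suc y
    X<3p = <-≤-trans (n<[1+n/p]*p X 3) (≤-trans (≤-reflexive (*-comm (suc t) 3)) (*-monoʳ-≤ 3 (≰⇒> p≰t)))
    X/p≡2 : X / suc y ≡ 2
    X/p≡2 = quotient-unique {q = 2} (≤-trans (≤-reflexive (cong (suc y +_) (+-identityʳ (suc y)))) (+-mono-≤ p≤m p≤m)) X<3p
    m<2p : m < 2 * suc y
    m<2p = ≰⇒> λ 2p≤m → <⇒≱ X<3p (≤-trans (*-monoˡ-≤ (suc y) {3} {4} (n≤1+n 3))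
      (≤-trans (≤-reflexive (*-distribʳ-+ (suc y) 2 2)) (+-mono-≤ 2p≤m 2p≤m)))
    m/p≡1 : m / suc y ≡ 1
    m/p≡1 = quotient-unique {q = 1} (≤-trans (≤-reflexive (*-identityˡ (suc y))) p≤m) m<2p

  C≤ : C ≤ X ^ π s * primorial t * X ^ (π X ∸ π m)
  C≤ = ≤-trans
    (bound-by-prime-powers h C (*³-mono (m^n>0 X (π (0 ⊓ s))) (primorial>0 (0 ⊓ t)) (m^n>0 X (π 0 ∸ π m))) h-mono h-gain X C
      (>-nonZero⁻¹ C {{C≢0}}) ∣-refl
      (λ p pr p∣C → prime∣!⇒≤ pr X (subst (p ∣_) C≡ (∣m⇒∣m*n _ p∣C))))
    (*³-mono (^-monoʳ-≤ X (π-mono (m⊓n≤n X s))) (primorial-mono (m⊓n≤n X t)) ≤-refl)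

  4^m≤ : 4 ^ m ≤ suc X * C
  4^m≤ = *-cancelʳ-≤ _ _ (∏! (m ∷ m ∷ [])) {{∏!-nonZero (m ∷ m ∷ [])}} (begin
    4 ^ m * ∏! (m ∷ m ∷ [])          ≡⟨ cong (λ z → 4 ^ m * (m ! * z)) (*-identityʳ (m !)) ⟩
    4 ^ m * (m ! * m !)              ≤⟨ 4^n*n!² m ⟩
    suc X * X !                      ≡⟨ cong (suc X *_) C≡ ⟨
    suc X * (C * ∏! (m ∷ m ∷ []))    ≡⟨ *-assoc (suc X) C _ ⟨
    suc X * C * ∏! (m ∷ m ∷ [])      ∎)
    where
    open ≤-Reasoning
    -- (2n + 2)² is enlarged to (2n + 3)(2n + 2), the factors that lead from (2n + 1)! to (2n + 3)!.
    4^n*n!² : ∀ n → 4 ^ n * (n ! * n !) ≤ suc (n + n) !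
    4^n*n!² zero    = ≤-refl
    4^n*n!² (suc n) = begin
      4 * 4 ^ n * (suc n * n ! * (suc n * n !))          ≡⟨ rearrange n (4 ^ n) (n !) ⟩
      (2 + (n + n)) * (2 + (n + n)) * (4 ^ n * (n ! * n !))
        ≤⟨ *-mono-≤ (*-monoˡ-≤ (2 + (n + n)) (n≤1+n (2 + (n + n)))) (4^n*n!² n) ⟩
      (3 + (n + n)) * (2 + (n + n)) * suc (n + n) !      ≡⟨ *-assoc (3 + (n + n)) (2 + (n + n)) (suc (n + n) !) ⟩
      (3 + (n + n)) !                                    ≡⟨ cong (λ k → (2 + k) !) (+-suc n n) ⟨
      suc (suc n + suc n) !                              ∎
      where
      rearrange : ∀ n a b → 4 * a * (suc n * b * (suc n * b)) ≡ (2 + (n + n)) * (2 + (n + n)) * (a * (b * b))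
      rearrange = solve-∀

central-binomial : ∀ m → ∃[ C ] C * ∏! (m ∷ m ∷ []) ≡ (m + m) !
central-binomial m with divides C eq ← m!*n!∣[m+n]! m m =
  C , trans (cong (λ z → C * (m ! * z)) (*-identityʳ (m !))) (sym eq)

-- Large m: from the product bound to exponents of 2

[48[1+k]]²≤2^k : ∀ {k} → 20 ≤′ k → 48 * suc k * (48 * suc k) ≤ 2 ^ k
-- 48 * 21 = 1008 is just below 2^10, and 48 is the largest factor that fits. The start k = 20
-- corresponds to m ≥ 2^19.
[48[1+k]]²≤2^k ≤′-refl = ≤ᵇ⇒≤ (48 * 21 * (48 * 21)) (2 ^ 20) _
[48[1+k]]²≤2^k {suc l} (≤′-step 20≤l) = begin
  48 * suc k * (48 * suc k)          ≡⟨ factor 48 (suc k) ⟩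
  48 * 48 * (suc k * suc k)          ≤⟨ *-monoʳ-≤ (48 * 48) [1+k]²≤2k² ⟩
  48 * 48 * (2 * (k * k))            ≡⟨ unfactor 48 k ⟩
  2 * (48 * k * (48 * k))            ≤⟨ *-monoʳ-≤ 2 ([48[1+k]]²≤2^k 20≤l) ⟩
  2 * 2 ^ l                          ∎
  where
  open ≤-Reasoning
  k = suc l
  factor : ∀ a k → a * k * (a * k) ≡ a * a * (k * k)
  factor = solve-∀
  unfactor : ∀ a k → a * a * (2 * (k * k)) ≡ 2 * (a * k * (a * k))
  unfactor = solve-∀
  [1+k]²≤2k² : suc k * suc k ≤ 2 * (k * k)
  [1+k]²≤2k² = begin
    suc k * suc k            ≡⟨ expand k ⟩
    k * k + (1 + 2 * k)      ≤⟨ +-monoʳ-≤ (k * k) (+-monoˡ-≤ (2 * k) (s≤s z≤n)) ⟩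
    k * k + (k + 2 * k)
      ≤⟨ +-monoʳ-≤ (k * k) (*-monoˡ-≤ k {3} {k} (≤-trans (≤ᵇ⇒≤ 3 20 _) (m≤n⇒m≤1+n (≤′⇒≤ 20≤l)))) ⟩
    k * k + k * k            ≡⟨ cong (k * k +_) (+-identityʳ (k * k)) ⟨
    2 * (k * k)              ∎
    where
    expand : ∀ k → suc k * suc k ≡ k * k + (1 + 2 * k)
    expand = solve-∀

-- With a = π (2m) and b = π m, this turns the negated claim into a bound of π(m)/2 for the number
-- of primes in (m, 2m].
2[a∸b]≤b : ∀ {a b} → 2 * a ≤ 3 * b → 2 * (a ∸ b) ≤ b
2[a∸b]≤b {a} {b} 2a≤3b = begin
  2 * (a ∸ b)          ≡⟨ *-distribˡ-∸ 2 a b ⟩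
  2 * a ∸ 2 * b        ≤⟨ ∸-monoˡ-≤ (2 * b) 2a≤3b ⟩
  b + 2 * b ∸ 2 * b    ≡⟨ m+n∸n≡m b (2 * b) ⟩
  b                    ∎
  where open ≤-Reasoning

module Exponents (m s t K a b e : ℕ) (3t≤2m : t * 3 ≤ m + m) (10a≤ : 10 * a ≤ m + 2750)
                 (10e≤ : 10 * e ≤ 2 * m + K * 2750) (6b≤ : 6 * b ≤ s + 84) (48K≤s : 48 * K ≤ s)
                 (s²≤2m : s * s ≤ m + m) (21≤K : 21 ≤ K) where
  open ≤-Reasoning

  -- Times 30, the main terms are 840m on the left and (440 + 330 + 21 + 42)m = 833m on the right,
  -- so 7m would be bounded by terms in K s, K and 1. Since 48K ≤ s and 168s² ≤ 336m, this becomes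
  -- 168s² ≤ 70s² + O(s), which s ≥ 1008 refutes.
  contradictory : ¬ m * 28 ≤ K * 14 + K * b * 14 + ((t * 11 + 360) * 2 + (m * 11 + 360)) + (a + e) * 7
  contradictory le = <⇒≱ (begin-strict
    s * 64050 + s * (70 * s) + 4327200       ≡⟨ swap (s * 64050) (s * (70 * s)) 4327200 ⟩
    -- 98 = 168 - 70, and 98 * 1008 = 64050 + 34734 covers both the linear term and the constant.
    s * (70 * s) + (s * 64050 + 4327200)     <⟨ +-monoʳ-< (s * (70 * s)) (+-monoʳ-< (s * 64050)
                                                  (<-≤-trans (<ᵇ⇒< 4327200 (1008 * 34734) _) (*-monoˡ-≤ 34734 1008≤s))) ⟩
    s * (70 * s) + (s * 64050 + s * 34734)   ≡⟨ cong (s * (70 * s) +_) (*-distribˡ-+ s 64050 34734) ⟨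
    s * (70 * s) + s * (98 * 1008)           ≤⟨ +-monoʳ-≤ (s * (70 * s)) (*-monoʳ-≤ s (*-monoʳ-≤ 98 1008≤s)) ⟩
    s * (70 * s) + s * (98 * s)              ≡⟨ factor s 70 98 ⟩
    s * s * 168                              ≤⟨ *-monoˡ-≤ 168 s²≤2m ⟩
    (m + m) * 168                            ≡⟨ double m ⟩
    m * 7 * 48                               ∎) 336m≤
    where
    1008≤s : 1008 ≤ s
    1008≤s = ≤-trans (*-monoʳ-≤ 48 21≤K) 48K≤s
    swap : ∀ a b c → a + b + c ≡ b + (a + c)
    swap = solve-∀
    factor : ∀ s a b → s * (a * s) + s * (b * s) ≡ s * s * (a + b)
    factor = solve-∀
    double : ∀ m → (m + m) * 168 ≡ m * 7 * 48
    double = solve-∀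
    group : ∀ K b t m a e c → (K * 14 + K * b * 14 + ((t * 11 + c) * 2 + (m * 11 + c)) + (a + e) * 7) * 30 ≡
            K * 420 + K * 70 * (6 * b) + t * 3 * 220 + m * 330 + c * 90 + 10 * a * 21 + 10 * e * 21
    group = solve-∀
    collect : ∀ K s m c d r → K * 420 + K * 70 * (s + r) + (m + m) * 220 + m * 330 + c * 90 + (m + d) * 21 +
              (2 * m + K * d) * 21 ≡
              m * 833 + (K * (420 + 70 * r + d * 21) + K * 70 * s + (c * 90 + d * 21))
    collect = solve-∀
    split : ∀ m → m * 833 + m * 7 ≡ m * 28 * 30
    split = solve-∀
    scale : ∀ K s x y → (K * x + K * 70 * s + y) * 48 ≡ 48 * K * x + 48 * K * (70 * s) + y * 48
    scale = solve-∀
    7m≤ : m * 7 ≤ K * 64050 + K * 70 * s + 90150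
    7m≤ = +-cancelˡ-≤ (m * 833) _ _ (begin
      m * 833 + m * 7       ≡⟨ split m ⟩
      m * 28 * 30           ≤⟨ *-monoˡ-≤ 30 le ⟩
      (K * 14 + K * b * 14 + ((t * 11 + 360) * 2 + (m * 11 + 360)) + (a + e) * 7) * 30
                            ≡⟨ group K b t m a e 360 ⟩
      K * 420 + K * 70 * (6 * b) + t * 3 * 220 + m * 330 + 360 * 90 + 10 * a * 21 + 10 * e * 21
        ≤⟨ +-mono-≤ (+-mono-≤ (+-monoˡ-≤ (360 * 90) (+-monoˡ-≤ (m * 330) (+-mono-≤ (+-monoʳ-≤ (K * 420) (*-monoʳ-≤ (K * 70) 6b≤))
             (*-monoˡ-≤ 220 3t≤2m)))) (*-monoˡ-≤ 21 10a≤)) (*-monoˡ-≤ 21 10e≤) ⟩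
      K * 420 + K * 70 * (s + 84) + (m + m) * 220 + m * 330 + 360 * 90 + (m + 2750) * 21 + (2 * m + K * 2750) * 21
                            ≡⟨ collect K s m 360 2750 84 ⟩
      m * 833 + (K * 64050 + K * 70 * s + 90150) ∎)
    336m≤ : m * 7 * 48 ≤ s * 64050 + s * (70 * s) + 4327200
    336m≤ = begin
      m * 7 * 48                                     ≤⟨ *-monoˡ-≤ 48 7m≤ ⟩
      (K * 64050 + K * 70 * s + 90150) * 48          ≡⟨ scale K s 64050 90150 ⟩
      48 * K * 64050 + 48 * K * (70 * s) + 4327200
        ≤⟨ +-monoˡ-≤ 4327200 (+-mono-≤ (*-monoˡ-≤ 64050 48K≤s) (*-monoˡ-≤ (70 * s) 48K≤s)) ⟩
      s * 64050 + s * (70 * s) + 4327200             ∎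

compare-exponents : ∀ {a u v x y p q} → p ^ 7 ≤ 2 ^ x → q ^ 7 ≤ 2 ^ y → 2 ^ a ≤ 2 ^ u * (p * p) * (2 ^ v * q) →
                    a * 7 ≤ u * 7 + (x + x) + (v * 7 + y)
compare-exponents {a} {u} {v} {x} {y} {p} {q} p≤ q≤ le = ^-cancelʳ-≤ {2} ≤-refl (begin
  2 ^ (a * 7)                                                ≡⟨ ^-*-assoc 2 a 7 ⟨
  (2 ^ a) ^ 7                                                ≤⟨ ^-monoˡ-≤ 7 le ⟩
  (2 ^ u * (p * p) * (2 ^ v * q)) ^ 7                        ≡⟨ ^-distribʳ-* (2 ^ u * (p * p)) (2 ^ v * q) 7 ⟩
  (2 ^ u * (p * p)) ^ 7 * (2 ^ v * q) ^ 7
    ≡⟨ cong₂ _*_ (^-distribʳ-* (2 ^ u) (p * p) 7) (^-distribʳ-* (2 ^ v) q 7) ⟩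
  (2 ^ u) ^ 7 * (p * p) ^ 7 * ((2 ^ v) ^ 7 * q ^ 7)
    ≡⟨ cong (λ z → (2 ^ u) ^ 7 * z * ((2 ^ v) ^ 7 * q ^ 7)) (^-distribʳ-* p p 7) ⟩
  (2 ^ u) ^ 7 * (p ^ 7 * p ^ 7) * ((2 ^ v) ^ 7 * q ^ 7)
    ≤⟨ *-mono-≤ (*-mono-≤ (≤-reflexive (^-*-assoc 2 u 7)) (*-mono-≤ p≤ p≤)) (*-mono-≤ (≤-reflexive (^-*-assoc 2 v 7)) q≤) ⟩
  2 ^ (u * 7) * (2 ^ x * 2 ^ x) * (2 ^ (v * 7) * 2 ^ y)
    ≡⟨ cong₂ (λ y z → 2 ^ (u * 7) * y * z) (^-distribˡ-+-* 2 x x) (^-distribˡ-+-* 2 (v * 7) y) ⟨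
  2 ^ (u * 7) * 2 ^ (x + x) * 2 ^ (v * 7 + y)
    ≡⟨ cong (_* 2 ^ (v * 7 + y)) (^-distribˡ-+-* 2 (u * 7) (x + x)) ⟨
  2 ^ (u * 7 + (x + x)) * 2 ^ (v * 7 + y)                    ≡⟨ ^-distribˡ-+-* 2 (u * 7 + (x + x)) (v * 7 + y) ⟨
  2 ^ (u * 7 + (x + x) + (v * 7 + y))                        ∎)
  where open ≤-Reasoning

-- The slope 1/6 serves for π(s): s is only of order √m, where the 2750 that comes with slope 1/10
-- would dominate at the start of the range.
3π<2π-large : ∀ m L → 19 ≤ L → (∀ t → π-Linear t) → (∀ t → 6 * π t ≤ t + 84) → 2 ^ L ≤ m → m < 2 ^ (suc L) →
       3 * π m < 2 * π (1 + 2 * m)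
3π<2π-large m L 19≤L lin lin₆ lo hi = ≰⇒> λ le → contra (begin
    2 * π X
      ≤⟨ *-monoʳ-≤ 2 (π-mono (≤-trans (≤-reflexive (cong (m +_) (sym (+-identityʳ m)))) (n≤1+n (2 * m)))) ⟩
    2 * π (1 + 2 * m)       ≤⟨ le ⟩
    3 * π m                 ∎)
  where
  open ≤-Reasoning
  X = m + m
  t = X / 3
  K = suc (suc L)
  s = proj₁ (√ X)
  s²≤X = proj₁ (proj₂ (√ X))
  X<[1+s]² = proj₂ (proj₂ (√ X))
  C = proj₁ (central-binomial m)
  e = dyadic (suc L) m
  2^[1+L]≤X : 2 ^ (suc L) ≤ X
  2^[1+L]≤X = ≤-trans (≤-reflexive (cong (2 ^ L +_) (+-identityʳ _))) (+-mono-≤ lo lo)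
  48*K≤s : 48 * K ≤ s
  48*K≤s = ≤-pred (≰⇒> λ s<48K → <⇒≱ X<[1+s]² (≤-trans (*-mono-≤ s<48K s<48K)
    (≤-trans ([48[1+k]]²≤2^k (≤⇒≤′ (s≤s 19≤L))) 2^[1+L]≤X)))
  1≤m : 1 ≤ m
  1≤m = ≤-trans (m^n>0 2 L) lo
  2≤s : 2 ≤ s
  2≤s = ≤-trans (≤-trans (s≤s (s≤s z≤n)) (m≤n*m K 48)) 48*K≤s
  open CentralBinomial m C s (proj₂ (central-binomial m)) 1≤m 2≤s X<[1+s]² using (C≤; 4^m≤)
  1+X≤ : suc X ≤ 2 ^ K
  1+X≤ = ≤-trans (+-mono-≤ hi (<⇒≤ hi)) (≤-reflexive (cong (2 ^ (suc L) +_) (sym (+-identityʳ _))))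
  instance
    X≢0 : NonZero X
    X≢0 = >-nonZero (≤-trans 1≤m (m≤m+n m m))
  X^πm≤ : X ^ π m ≤ 2 ^ (π m + e) * primorial m
  X^πm≤ = begin
    X ^ π m
      ≤⟨ ^-monoˡ-≤ (π m) (≤-trans (+-mono-≤ (n≤1+n m) (n≤1+n m)) (≤-reflexive (cong (suc m +_) (sym (+-identityʳ _))))) ⟩
    (2 * suc m) ^ π m                            ≡⟨ ^-distribʳ-* 2 (suc m) (π m) ⟩
    2 ^ π m * suc m ^ π m                        ≤⟨ *-monoʳ-≤ (2 ^ π m) (dyadic-bound (suc L) m hi) ⟩
    2 ^ π m * (2 ^ e * primorial m)              ≡⟨ *-assoc (2 ^ π m) (2 ^ e) (primorial m) ⟨
    2 ^ π m * 2 ^ e * primorial m                ≡⟨ cong (_* primorial m) (^-distribˡ-+-* 2 (π m) e) ⟨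
    2 ^ (π m + e) * primorial m                  ∎
  contra : ¬ 2 * π X ≤ 3 * π m
  contra 2πX≤3πm = Exponents.contradictory m s t K (π m) (π s) e (m/n*n≤m X 3) (lin m)
    (≤-trans (dyadic-linear (suc L) m λ u _ → lin u) (+-monoʳ-≤ (2 * m) (*-monoˡ-≤ 2750 (n≤1+n (suc L)))))
    (lin₆ s) 48*K≤s s²≤X (s≤s (s≤s 19≤L))
    exponents
    where
    D = π X ∸ π m
    square : 4 ^ m * 4 ^ m ≤
             (2 ^ K * 2 ^ K) * (2 ^ (K * π s) * 2 ^ (K * π s)) * (primorial t * primorial t) * (2 ^ (π m + e) * primorial m)
    square = begin
      4 ^ m * 4 ^ m                                       ≤⟨ *-mono-≤ 4^m≤′ 4^m≤′ ⟩
      2 ^ K * (2 ^ (K * π s) * P * X ^ D) * (2 ^ K * (2 ^ (K * π s) * P * X ^ D))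
          ≡⟨ rearrange (2 ^ K) (2 ^ (K * π s)) P (X ^ D) ⟩
      2 ^ K * 2 ^ K * (2 ^ (K * π s) * 2 ^ (K * π s)) * (P * P) * (X ^ D * X ^ D)
          ≤⟨ *-monoʳ-≤ (2 ^ K * 2 ^ K * (2 ^ (K * π s) * 2 ^ (K * π s)) * (P * P)) X^2D≤ ⟩
      2 ^ K * 2 ^ K * (2 ^ (K * π s) * 2 ^ (K * π s)) * (P * P) * (2 ^ (π m + e) * primorial m) ∎
      where
      P = primorial t
      4^m≤′ : 4 ^ m ≤ 2 ^ K * (2 ^ (K * π s) * P * X ^ D)
      4^m≤′ = ≤-trans 4^m≤ (*-mono-≤ 1+X≤ (≤-trans C≤ (*-monoˡ-≤ (X ^ D) (*-monoˡ-≤ P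
        (≤-trans (^-monoˡ-≤ (π s) (≤-trans (n≤1+n X) 1+X≤)) (≤-reflexive (^-*-assoc 2 K (π s))))))))
      -- The negated claim enters here, as 2D ≤ π m; the square of X^D is what makes it applicable.
      X^2D≤ : X ^ D * X ^ D ≤ 2 ^ (π m + e) * primorial m
      X^2D≤ = ≤-trans (≤-reflexive (trans (sym (^-distribˡ-+-* X D D)) (cong (λ k → X ^ (D + k)) (sym (+-identityʳ D)))))
        (≤-trans (^-monoʳ-≤ X (2[a∸b]≤b {π X} {π m} 2πX≤3πm)) X^πm≤)
      rearrange : ∀ a b p x → a * (b * p * x) * (a * (b * p * x)) ≡ a * a * (b * b) * (p * p) * (x * x)
      rearrange = solve-∀
    exponents : m * 28 ≤ K * 14 + K * π s * 14 + ((t * 11 + 360) * 2 + (m * 11 + 360)) + (π m + e) * 7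
    exponents = begin
      m * 28                                                    ≡⟨ 28m m ⟩
      (2 * m + 2 * m) * 7
        ≤⟨ compare-exponents {2 * m + 2 * m} {K + K + (K * π s + K * π s)} {π m + e} {x} {y} {primorial t} {primorial m}
            (primorial^7≤2^[11n+360] t) (primorial^7≤2^[11n+360] m) square′ ⟩
      (K + K + (K * π s + K * π s)) * 7 + (x + x) + ((π m + e) * 7 + y) ≡⟨ regroup K (K * π s) x y (π m + e) ⟩
      K * 14 + K * π s * 14 + (x * 2 + y) + (π m + e) * 7       ∎
      where
      x = t * 11 + 360
      y = m * 11 + 360
      square′ : 2 ^ (2 * m + 2 * m) ≤
                2 ^ (K + K + (K * π s + K * π s)) * (primorial t * primorial t) * (2 ^ (π m + e) * primorial m)
      square′ = subst₂ _≤_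
        (sym (trans (^-distribˡ-+-* 2 (2 * m) (2 * m)) (cong₂ _*_ (sym (^-*-assoc 2 2 m)) (sym (^-*-assoc 2 2 m)))))
        (cong (λ z → z * (primorial t * primorial t) * (2 ^ (π m + e) * primorial m))
          (sym (trans (^-distribˡ-+-* 2 (K + K) (K * π s + K * π s))
          (cong₂ _*_ (^-distribˡ-+-* 2 K K) (^-distribˡ-+-* 2 (K * π s) (K * π s)))))) square
      28m : ∀ m → m * 28 ≡ (2 * m + 2 * m) * 7
      28m = solve-∀
      regroup : ∀ K k x y v → (K + K + (k + k)) * 7 + (x + x) + (v * 7 + y) ≡ K * 14 + k * 14 + (x * 2 + y) + v * 7
      regroup = solve-∀

-- Verification up to 2^19

smallPrimes : List ℕ
smallPrimes = 
  2 ∷ 3 ∷ 5 ∷ 7 ∷ 11 ∷ 13 ∷ 17 ∷ 19 ∷ 23 ∷ 29 ∷ 31 ∷ 37 ∷ 41 ∷ 43 ∷ 47 ∷ 53 ∷ 59 ∷ 61 ∷ 67 ∷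
  71 ∷ 73 ∷ 79 ∷ 83 ∷ 89 ∷ 97 ∷ 101 ∷ 103 ∷ 107 ∷ 109 ∷ 113 ∷ 127 ∷ 131 ∷ 137 ∷ 139 ∷ 149 ∷
  151 ∷ 157 ∷ 163 ∷ 167 ∷ 173 ∷ 179 ∷ 181 ∷ 191 ∷ 193 ∷ 197 ∷ 199 ∷ 211 ∷ 223 ∷ 227 ∷ 229 ∷
  233 ∷ 239 ∷ 241 ∷ 251 ∷ 257 ∷ 263 ∷ 269 ∷ 271 ∷ 277 ∷ 281 ∷ 283 ∷ 293 ∷ 307 ∷ 311 ∷ 313 ∷
  317 ∷ 331 ∷ 337 ∷ 347 ∷ 349 ∷ 353 ∷ 359 ∷ 367 ∷ 373 ∷ 379 ∷ 383 ∷ 389 ∷ 397 ∷ 401 ∷ 409 ∷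
  419 ∷ 421 ∷ 431 ∷ 433 ∷ 439 ∷ 443 ∷ 449 ∷ 457 ∷ 461 ∷ 463 ∷ 467 ∷ 479 ∷ 487 ∷ 491 ∷ 499 ∷
  503 ∷ 509 ∷ 521 ∷ 523 ∷ 541 ∷ 547 ∷ 557 ∷ 563 ∷ 569 ∷ 571 ∷ 577 ∷ 587 ∷ 593 ∷ 599 ∷ 601 ∷
  607 ∷ 613 ∷ 617 ∷ 619 ∷ 631 ∷ 641 ∷ 643 ∷ 647 ∷ 653 ∷ 659 ∷ 661 ∷ 673 ∷ 677 ∷ 683 ∷ 691 ∷
  701 ∷ 709 ∷ 719 ∷ 727 ∷ 733 ∷ 739 ∷ 743 ∷ 751 ∷ 757 ∷ 761 ∷ 769 ∷ 773 ∷ 787 ∷ 797 ∷ 809 ∷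
  811 ∷ 821 ∷ 823 ∷ 827 ∷ 829 ∷ 839 ∷ 853 ∷ 857 ∷ 859 ∷ 863 ∷ 877 ∷ 881 ∷ 883 ∷ 887 ∷ 907 ∷
  911 ∷ 919 ∷ 929 ∷ 937 ∷ 941 ∷ 947 ∷ 953 ∷ 967 ∷ 971 ∷ 977 ∷ 983 ∷ 991 ∷ 997 ∷ 1009 ∷ 1013 ∷
  1019 ∷ 1021 ∷ []

-- Exhausting the list returns `true`. This can be trusted when every d ≥ 2 with d² ≤ n has a
-- divisor in the list, which `Covered N` provides for n ≤ N².
trial : List ℕ → ℕ → Bool
trial []           n = true
trial (zero ∷ ps)  n = trial ps n
trial (suc q ∷ ps) n =
  if n <ᵇ suc q * suc q then true else
  if n % suc q ≡ᵇ 0 then false else trial ps n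

trial-false : ∀ {ps} → All (2 ≤_) ps → trial ps n ≡ false → ∃ λ d → 2 ≤ d × d ∣ n × d * d ≤ n
trial-false {n} {suc q ∷ ps} (2≤p ∷ 2≤ps) eq with n <ᵇ suc q * suc q in lt
... | false with n % suc q ≡ᵇ 0 in dv
...   | false = trial-false 2≤ps eq
...   | true  = suc q , 2≤p , m%n≡0⇒n∣m n (suc q) (≡ᵇ⇒≡ _ _ (subst T (sym dv) tt)) ,
                ≮⇒≥ λ n<p² → subst T lt (<⇒<ᵇ n<p²)

trial-true : ∀ {ps p} → AllPairs _≤_ ps → All (2 ≤_) ps → trial ps n ≡ true → p ∈ ps → p * p ≤ n → ¬ p ∣ n
trial-true {n} {suc q ∷ ps} (q≤ ∷ sorted) (_ ∷ 2≤ps) eq p∈ p²≤n p∣n with n <ᵇ suc q * suc q in lt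
... | true  = <⇒≱ (<ᵇ⇒< n _ (subst T (sym lt) tt)) (≤-trans (*-mono-≤ q≤p q≤p) p²≤n)
  where
  q≤p = case p∈ of λ { (here refl) → ≤-refl ; (there p∈ps) → All.lookup q≤ p∈ps }
... | false with n % suc q ≡ᵇ 0 in dv | p∈
...   | false | here refl  = subst T dv (≡⇒≡ᵇ (n % suc q) 0 (n∣m⇒m%n≡0 n (suc q) p∣n))
...   | false | there p∈ps = trial-true sorted 2≤ps eq p∈ps p²≤n p∣n

isPrime : ℕ → Bool
isPrime = trial smallPrimes

smallPrimes≥2 : All (2 ≤_) smallPrimes
smallPrimes≥2 = toWitness {a? = all? (2 ≤?_) smallPrimes} tt

smallPrimes-sorted : AllPairs _≤_ smallPrimes
smallPrimes-sorted = toWitness {a? = allPairs? _≤?_ smallPrimes} tt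

Covered : ℕ → Set
Covered N = ∀ {d} → d < suc N → 2 ≤ d → Any (_∣ d) smallPrimes

-- 1031 is the next prime, so 1030 is the limit of this list; its square exceeds 2^20 + 5, which
-- bounds the numbers tested.
smallPrimes-cover : Covered 1030
smallPrimes-cover = toWitness {a? = allUpTo? (λ d → (2 ≤? d) →-dec any? (_∣? d) smallPrimes) 1031} tt

isPrime-false : isPrime n ≡ false → ¬ Prime n
isPrime-false {n} eq pr with d , 2≤d , d∣n , d²≤n ← trial-false smallPrimes≥2 eq =
  prime⇒¬composite pr (hasNonTrivialDivisor {divisor = d} {{n>1⇒nonTrivial 2≤d}} d<n d∣n)
  where d<n = <-≤-trans (m<m*n d d {{>-nonZero (<-trans z<s 2≤d)}} 2≤d) d²≤n

-- The smaller factor in n = e * d has square at most n, so it is at most N and has a listed prime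
-- divisor, which trial division would have met.
isPrime-true : ∀ N → Covered N → 2 ≤ n → n ≤ N * N → isPrime n ≡ true → Prime n
isPrime-true {n} N cover 2≤n n≤N² eq with prime? n
... | yes pr = pr
... | no ¬pr with composite {d} d<n d∣n ← ¬prime⇒composite {{n>1⇒nonTrivial 2≤n}} ¬pr =
  ⊥-elim (case (≤-total d e) of λ
    { (inj₁ d≤e) → noDivisor d 2≤d (subst (d * d ≤_) (sym n≡e*d) (*-monoˡ-≤ d d≤e)) d∣n
    ; (inj₂ e≤d) → noDivisor e (quotient>1 d∣n d<n) (subst (e * e ≤_) (sym n≡e*d) (*-monoʳ-≤ e e≤d))
                     (quotient-∣ d∣n) })
  where
  e = quotient d∣n
  n≡e*d : n ≡ e * d
  n≡e*d = _∣_.equality d∣n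
  2≤d : 2 ≤ d
  2≤d = nonTrivial⇒n>1 d
  noDivisor : ∀ d → 2 ≤ d → d * d ≤ n → ¬ d ∣ n
  noDivisor d 2≤d d²≤n d∣n with d≤N ← ≮⇒≥ {N} {d} (λ N<d →
                                  <⇒≱ (*-mono-< N<d N<d) (≤-trans d²≤n n≤N²))
    with p , p∈ , p∣d ← find (cover (s≤s d≤N) 2≤d)
    with p≤d ← ∣⇒≤ {{>-nonZero (<-trans z<s 2≤d)}} p∣d =
    trial-true smallPrimes-sorted smallPrimes≥2 eq p∈ (≤-trans (*-mono-≤ p≤d p≤d) d²≤n) (∣-trans p∣d d∣n)

count : Bool → ℕ → ℕ
count true  k = suc k
count false k = k

π-count : ∀ N → Covered N → suc n ≤ N * N → 1 ≤ n → π (suc n) ≡ count (isPrime (suc n)) (π n)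
π-count {n} N cover n≤ 1≤n with isPrime (suc n) in eq
... | true  = π-prime (isPrime-true N cover (s≤s 1≤n) n≤ eq)
... | false = π-nonprime (isPrime-false {suc n} eq)

-- a and b run through π m and π (2m + 1).
boundsᵇ : ℕ → ℕ → ℕ → Bool
boundsᵇ m a b =
  if (3 * a <ᵇ 2 * b) ∨ not (isPrime (1 + 2 * m)) then
  if 10 * a ≤ᵇ m + 2750 then 6 * a ≤ᵇ m + 84
  else false else false

-- Both counts are carried along and updated through `isPrime`, so `π` with its slow `prime?` is
-- never evaluated. The even number 2m + 2 adds nothing to b.
checkFrom : ℕ → ℕ → ℕ → ℕ → Bool
checkFrom zero    m a b = true
checkFrom (suc f) m a b =
  if boundsᵇ m a b
  then checkFrom f (suc m) (count (isPrime (suc m)) a) (count (isPrime (3 + 2 * m)) b)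
  else false

-- The primality guard matters: at m = 7 both sides of the strict inequality are 12, and 15 is
-- composite.
Bounds : ℕ → Set
Bounds m = (Prime (1 + 2 * m) → 3 * π m < 2 * π (1 + 2 * m)) × 10 * π m ≤ m + 2750 × 6 * π m ≤ m + 84

boundsᵇ-sound : ∀ m → boundsᵇ m (π m) (π (1 + 2 * m)) ≡ true → Bounds m
boundsᵇ-sound m eq
  with 3 * π m <ᵇ 2 * π (1 + 2 * m) in e₁ | isPrime (1 + 2 * m) in e₂ | 10 * π m ≤ᵇ m + 2750 in e₃
... | true  | _     | true = (λ _ → <ᵇ⇒< _ _ (subst T (sym e₁) tt))
                           , ≤ᵇ⇒≤ _ _ (subst T (sym e₃) tt) , ≤ᵇ⇒≤ _ _ (subst T (sym eq) tt)
... | false | false | true = (λ pr → ⊥-elim (isPrime-false {1 + 2 * m} e₂ pr))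
                           , ≤ᵇ⇒≤ _ _ (subst T (sym e₃) tt) , ≤ᵇ⇒≤ _ _ (subst T (sym eq) tt)
... | true  | _     | false with () ← eq

π-odd : ∀ N → Covered N → 1 ≤ m → 3 + 2 * m ≤ N * N → π (3 + 2 * m) ≡ count (isPrime (3 + 2 * m)) (π (1 + 2 * m))
π-odd {m} N cover 1≤m le = trans (π-count {2 + 2 * m} N cover le (s≤s z≤n))
  (cong (count (isPrime (3 + 2 * m))) (π-nonprime ¬pr))
  where
  ¬pr : ¬ Prime (2 + 2 * m)
  ¬pr pr = prime⇒¬composite pr (composite {d = 2} (s≤s (s≤s (≤-trans 1≤m (m≤m+n m _)))) (divides (suc m) eq))
    where
    eq : 2 + 2 * m ≡ suc m * 2
    eq = cong (2 +_) (*-comm 2 m)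

checkFrom-sound : ∀ N → Covered N → ∀ f m a b → a ≡ π m → b ≡ π (1 + 2 * m) → 1 ≤ m → 3 + 2 * (f + m) ≤ N * N →
             checkFrom f m a b ≡ true → ∀ j → j < f → Bounds (j + m)
checkFrom-sound N cover (suc f) m _ _ refl refl 1≤m bound eq j j<f with boundsᵇ m (π m) (π (1 + 2 * m)) in ok
checkFrom-sound N cover (suc f) m _ _ refl refl 1≤m bound eq zero    j<f       | true = boundsᵇ-sound m ok
checkFrom-sound N cover (suc f) m _ _ refl refl 1≤m bound eq (suc j) (s≤s j<f) | true =
  subst Bounds (+-suc j m)
      (checkFrom-sound N cover f (suc m) _ _
      (sym (π-count {m} N cover (≤-trans (s≤s (≤-trans (m≤m+n m _) (m≤n+m _ 2))) odd≤) 1≤m))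
      (trans (sym (π-odd {m} N cover 1≤m odd≤)) (cong π eq₂)) (s≤s z≤n) bound′ eq j j<f)
  where
  bound′ : 3 + 2 * (f + suc m) ≤ N * N
  bound′ = subst (λ k → 3 + 2 * k ≤ N * N) (sym (+-suc f m)) bound
  odd≤ : 3 + 2 * m ≤ N * N
  odd≤ = ≤-trans (+-monoʳ-≤ 3 (*-monoʳ-≤ 2 (m≤n+m m (suc f)))) bound
  eq₂ : 3 + 2 * m ≡ 1 + 2 * suc m
  eq₂ = cong suc (sym (*-suc 2 m))

check-true : checkFrom (2 ^ 19) 1 0 2 ≡ true
check-true = refl

bounds-upto : ∀ m → 1 ≤ m → m ≤ 2 ^ 19 → Bounds m
bounds-upto (suc m) _ m<2^19 = subst Bounds (+-comm m 1)
  (checkFrom-sound 1030 smallPrimes-cover (2 ^ 19) 1 0 2 refl refl ≤-refl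
    (≤ᵇ⇒≤ (3 + 2 * (2 ^ 19 + 1)) (1030 * 1030) tt) check-true m m<2^19)

-- Joining the computed range and the large m

3π<2π-beyond : ∀ N → 4000 ≤ N → 2 ^ 19 ≤ N → (∀ m → 1 ≤ m → m ≤ N → Bounds m) →
             ∀ m → 1 ≤ m → Prime (1 + 2 * m) → 3 * π m < 2 * π (1 + 2 * m)
3π<2π-beyond N 4000≤N 2^19≤N bounds (suc m) 1≤m pr with suc m ≤? N
... | yes m≤N = proj₁ (bounds (suc m) 1≤m m≤N) pr
... | no m≰N with L , lo , hi ← log₂ m =
  3π<2π-large (suc m) L (log-large 19 (≤-trans 2^19≤N (<⇒≤ (≰⇒> m≰N))) hi) lin lin₆ lo hi
  where
  lin : ∀ t → π-Linear t
  lin = π-linear N (≤-trans (≤ᵇ⇒≤ 3000 4000 _) 4000≤N) 2^19≤N λ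
    { zero    _   → z≤n
    ; (suc t) t<N → proj₁ (proj₂ (bounds (suc t) (s≤s z≤n) (<⇒≤ t<N))) }
  lin₆ : ∀ t → 6 * π t ≤ t + 84
  lin₆ zero = z≤n
  lin₆ (suc t) with suc t ≤? N
  ... | yes t≤N = proj₂ (proj₂ (bounds (suc t) (s≤s z≤n) t≤N))
  ... | no t≰N = *-cancelʳ-≤ _ _ 10 (begin
    6 * π u * 10                  ≡⟨ swap 6 (π u) 10 ⟩
    10 * π u * 6                  ≤⟨ *-monoˡ-≤ 6 (lin u) ⟩
    (u + 2750) * 6                ≡⟨ *-distribʳ-+ 6 u 2750 ⟩
    -- Since u > N ≥ 4000, 16500 ≤ 4u + 840: beyond N the bound of slope 1/10 implies the one of
    -- slope 1/6.
    u * 6 + 16500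
      ≤⟨ +-monoʳ-≤ (u * 6) (≤-trans (≤ᵇ⇒≤ 16500 (4000 * 4 + 840) _) (+-monoˡ-≤ 840 (*-monoˡ-≤ 4 (≤-trans 4000≤N (<⇒≤ (≰⇒> t≰N)))))) ⟩
    u * 6 + (u * 4 + 840)         ≡⟨ regroup u 6 4 840 ⟩
    u * 10 + 840                  ≡⟨ *-distribʳ-+ 10 u 84 ⟨
    (u + 84) * 10                 ∎)
    where
    open ≤-Reasoning
    u = suc t
    swap : ∀ a b c → a * b * c ≡ c * b * a
    swap = solve-∀
    regroup : ∀ u a b c → u * a + (u * b + c) ≡ u * (a + b) + c
    regroup = solve-∀

3π<2π : ∀ m → 1 ≤ m → Prime (1 + 2 * m) → 3 * π m < 2 * π (1 + 2 * m)
3π<2π = 3π<2π-beyond (2 ^ 19) (≤ᵇ⇒≤ 4000 (2 ^ 19) _) ≤-refl bounds-upto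

even-prime : Prime p → p % 2 ≡ 0 → 2 ≡ p
even-prime {p} pr p%2≡0 = [ (λ ()) , id ]′ (prime⇒irreducible pr (m%n≡0⇒n∣m p 2 p%2≡0))

theorem4 : ∀ (n p : ℕ) → n ≥ 1 → IsNthPrime (3 * n) p →
    π p ∸ π (p / 2) > n
theorem4 n p n≥1 (pr , πp≡3n) with p % 2 in p%2≡ | m%n<n p 2 | m≡m%n+[m/n]*n p 2
-- An even p is 2, but π 2 = 1 < 3n.
... | zero  | _ | _ = contradiction (trans (cong π (even-prime pr p%2≡)) πp≡3n)
  (<⇒≢ (≤-trans (s≤s (s≤s z≤n)) (*-monoʳ-≤ 3 n≥1)))
... | suc (suc _) | s≤s (s≤s ()) | _
-- π h < 2n, so more than n of the 3n primes up to p exceed h.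
... | suc zero | _ | p≡ = m+n≤o⇒m≤o∸n (suc n) (begin
  suc n + π h      ≡⟨ +-suc n (π h) ⟨
  n + suc (π h)    ≤⟨ +-monoʳ-≤ n (*-cancelˡ-< 3 (π h) (2 * n) 3πh<3[2n]) ⟩
  3 * n            ≡⟨ πp≡3n ⟨
  π p              ∎)
  where
  open ≤-Reasoning
  h = p / 2
  p≡1+2h : p ≡ 1 + 2 * h
  p≡1+2h = trans p≡ (cong suc (*-comm h 2))
  1≤h : 1 ≤ h
  1≤h = m≥n⇒m/n>0 (nonTrivial⇒n>1 p {{prime⇒nonTrivial pr}})
  swap : ∀ n → 2 * (3 * n) ≡ 3 * (2 * n)
  swap = solve-∀
  3πh<3[2n] : 3 * π h < 3 * (2 * n)
  3πh<3[2n] = begin-strict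
    3 * π h                <⟨ 3π<2π h 1≤h (subst Prime p≡1+2h pr) ⟩
    2 * π (1 + 2 * h)      ≡⟨ cong (λ k → 2 * π k) p≡1+2h ⟨
    2 * π p                ≡⟨ cong (2 *_) πp≡3n ⟩
    2 * (3 * n)            ≡⟨ swap n ⟩
    3 * (2 * n)            ∎
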